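{- Let $l,m,n$ be positive integers with $l\le\min\{m,n\}$, and let $x,y,z$ be complex numbers with $x+y+z=1$. Then $$(-1)^m\sum_{k=0}^m\binom mk\binom{n+k}{l-1}B_{n-l+k+1}(x)E_{m-k}(z)+(-1)^{n-l}\sum_{k=0}^n\binom nk\binom{m+k}{l-1}B_{m-l+k+1}(y)E_{n-k}(z)=-\frac l2\sum_{k=0}^l(-1)^k\binom mk\binom n{l-k}E_{n-l+k}(x)E_{m-k}(y),$$ $$\sum_{k=0}^{l}(-1)^k\binom mk\binom n{l-k}B_{m-k}(x)E_{n-l+k}(z)-(-1)^m\sum_{k=0}^m\binom mk\binom{n+k}{l}B_{m-k}(y)E_{n-l+k}(z)=(-1)^{n-l-1}\frac m2\sum^n_{k=\delta_{l,m}}\binom nk\binom{m+k-1}{l}E_{n-k}(y)E_{m-l-1+k}(x),$$ and $$\frac{(-1)^m}m\sum_{k=0}^m\binom mk\binom{n+k-1}{l-1}B_{n-l+k}(x)B_{m-k}(z)+(-1)^l\frac{(-1)^n}n\sum_{k=0}^n\binom nk\binom{m+k-1}{l-1}B_{m-l+k}(y)B_{n-k}(z)=\frac l{mn}\sum_{k=0}^l(-1)^k\binom mk\binom n{l-k}B_{n-l+k}(x)B_{m-k}(y).$$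
   Context: $\delta_{l,m}$ equals $1$ if $l=m$ and $0$ otherwise. Bernoulli numbers: $B_0=1$ and $\sum_{k=0}^n\binom{n+1}kB_k=0$ for $n\ge1$. Euler numbers: $E_0=1$ and $\sum_{0\le k\le n,\ 2\mid n-k}\binom nkE_k=0$ for $n\ge1$. Bernoulli polynomials $B_n(x)=\sum_{k=0}^n\binom nkB_kx^{n-k}$; Euler polynomials $E_n(x)=\sum_{k=0}^n\binom nk\frac{E_k}{2^k}(x-\tfrac12)^{n-k}$. Binomial coefficients are the usual ones for nonnegative integers (zero if the lower index exceeds the upper). -}

module Defs where

open import Level using (Level)
open import Data.Nat as ℕ using (ℕ; zero; suc; _∸_)
open import Data.Nat.Combinatorics using (_C_)
open import Data.Nat.Properties using (_≟_)
open import Data.List using (List; []; _∷_; _++_; [_]; length)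
open import Data.Integer as ℤ using (ℤ)
open import Data.Rational as ℚ using (ℚ)
open import Relation.Nullary using (yes; no)
open import Algebra.Bundles using (CommutativeRing)

δ : ℕ → ℕ → ℕ
δ l m with l ≟ m
... | yes _ = 1
... | no  _ = 0

ℕ→ℚ : ℕ → ℚ
ℕ→ℚ n = ℤ.+ n ℚ./ 1

sumIdx : (ℕ → ℚ → ℚ) → ℕ → List ℚ → ℚ
sumIdx f k []       = ℚ.0ℚ
sumIdx f k (x ∷ xs) = f k x ℚ.+ sumIdx f (suc k) xs

-- nth element (with a default, never used for valid indices)
nth : List ℚ → ℕ → ℚ
nth []       _       = ℚ.0ℚ
nth (x ∷ xs) zero    = x
nth (x ∷ xs) (suc k) = nth xs k

-- [B_0, ..., B_n], using  B_0 = 1  and  Σ_{k=0}^{N} C(N+1,k) B_k = 0  (N ≥ 1), i.e.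
-- B_N = -(1/(N+1)) Σ_{k<N} C(N+1,k) B_k
bernUpTo : ℕ → List ℚ
bernUpTo zero    = [ ℚ.1ℚ ]
bernUpTo (suc n) =
  bernUpTo n ++
  [ ℚ.- ((ℤ.+ 1 ℚ./ suc (suc n)) ℚ.* sumIdx (λ k b → ℕ→ℚ (suc (suc n) C k) ℚ.* b) 0 (bernUpTo n)) ]

Bern : ℕ → ℚ
Bern n = nth (bernUpTo n) n

-- [E_0, ..., E_n], using  E_0 = 1  and  Σ_{k≤N, 2 ∣ N-k} C(N,k) E_k = 0  (N ≥ 1), i.e.
-- E_N = - Σ_{k<N, N-k even} C(N,k) E_k
even? : ℕ → ℚ
even? zero          = ℚ.1ℚ
even? (suc zero)    = ℚ.0ℚ
even? (suc (suc n)) = even? n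

eulUpTo : ℕ → List ℚ
eulUpTo zero    = [ ℚ.1ℚ ]
eulUpTo (suc n) =
  eulUpTo n ++
  [ ℚ.- sumIdx (λ k e → even? (suc n ∸ k) ℚ.* (ℕ→ℚ (suc n C k) ℚ.* e)) 0 (eulUpTo n) ]

Eul : ℕ → ℚ
Eul n = nth (eulUpTo n) n

sgn : ℕ → ℚ
sgn zero    = ℚ.1ℚ
sgn (suc n) = ℚ.- sgn n

-- 1/n in ℚ for n ≥ 1 (junk value 0 at n = 0; only used with n ≥ 1)
inv : ℕ → ℚ
inv zero    = ℚ.0ℚ
inv (suc n) = ℤ.+ 1 ℚ./ suc n

inv2^ : ℕ → ℚ
inv2^ zero    = ℚ.1ℚ
inv2^ (suc n) = (ℤ.+ 1 ℚ./ 2) ℚ.* inv2^ n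

-- Polynomial-side definitions in a commutative ring R with a map ι : ℚ → R
-- (in the theorem, ι is required to be a ring homomorphism, i.e. R is a ℚ-algebra, e.g. ℂ).
module Poly {c ℓ : Level} (R : CommutativeRing c ℓ) (ι : ℚ → CommutativeRing.Carrier R) where
  open CommutativeRing R

  pow : Carrier → ℕ → Carrier
  pow x zero    = 1#
  pow x (suc n) = x * pow x n

  sumCount : ℕ → ℕ → (ℕ → Carrier) → Carrier
  sumCount zero      a f = 0#
  sumCount (suc cnt) a f = f a + sumCount cnt (suc a) f

  -- Σ_{k=a}^{b} f k   (empty if a > b)
  Σ[_≤k≤_] : ℕ → ℕ → (ℕ → Carrier) → Carrier
  Σ[ a ≤k≤ b ] f = sumCount (suc b ∸ a) a f

  q : ℚ → Carrier
  q = ι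

  bin : ℕ → ℕ → Carrier
  bin a b = ι (ℕ→ℚ (a C b))

  BP : ℕ → Carrier → Carrier
  BP n x = Σ[ 0 ≤k≤ n ] (λ k → bin n k * (ι (Bern k) * pow x (n ∸ k)))

  EP : ℕ → Carrier → Carrier
  EP n x = Σ[ 0 ≤k≤ n ] (λ k → bin n k * (ι (Eul k ℚ.* inv2^ k) * pow (x - ι (ℤ.+ 1 ℚ./ 2)) (n ∸ k)))

{-# OPTIONS --safe #-}

-- Work with exponential generating functions in two variables a and b, and put c = a - b.  Writing
-- B_x(t) = Σ B_n(x) t^n/n! and E_x(t) = Σ E_n(x) t^n/n!, so that B_x(t)(e^t - 1) = t e^{xt} and
-- E_x(t)(e^t + 1) = 2 e^{xt}, the hypothesis x + y + z = 1 gives, after clearing denominators,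
--   2 (B_x(c) E_z(-b) - B_y(-c) E_z(-a)) = - c E_x(a) E_y(b),
--   a B_x(c) B_z(-b) - b B_y(-c) B_z(-a) = c B_x(a) B_y(b).
-- Multiplying by c^{l-1}/(l-1)! and comparing the coefficients of a^n b^m yields the first and the third
-- identity.  The second one comes in the same way from the first equation under
-- (a , b , c) ↦ (- c , - a , b), multiplied by c^l/l!.
--
-- A series Σ f_n t^n/n! is represented by its sequence of coefficients f_n.  In this normalisation
-- the derivative is the shift and f(sa + tb) has the coefficients s^i t^j f_{i+j}.

module Submission where

open import Defs
open import Level using (Level)
open import Data.Nat as ℕ using (ℕ; zero; suc; _∸_; _≤_; _<_; z≤n; s≤s)
open import Data.Nat.Combinatorics using (_C_; nCk+nC[k+1]≡[n+1]C[k+1]; k>n⇒nCk≡0; nCk≡nC[n∸k]; nCn≡1; nC1≡n)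
import Data.Nat.Properties as ℕₚ
open import Data.Integer as ℤ using (ℤ)
import Data.Integer.Properties as ℤₚ
open import Data.List using (List; []; _∷_; _++_; [_]; length)
open import Data.List.Properties using (length-++)
open import Data.Maybe using (Maybe; just; nothing)
open import Data.Product using (_×_; _,_)
open import Data.Rational as ℚ using (ℚ; toℚᵘ)
open import Data.Rational.Properties as ℚₚ using (+-*-commutativeRing; toℚᵘ-injective; toℚᵘ-fromℚᵘ; toℚᵘ-homo-+; toℚᵘ-homo-*)
open import Data.Rational.Unnormalised as ℚᵘ using (mkℚᵘ; *≡*)
import Data.Rational.Unnormalised.Properties as ℚᵘₚ
open import Data.Sum using (_⊎_; inj₁; inj₂)
open import Algebra.Bundles using (CommutativeRing)
open import Algebra.Morphism.Structures using (module RingMorphisms)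
open import Algebra.Solver.Ring.AlmostCommutativeRing using (fromCommutativeRing; _-Raw-AlmostCommutative⟶_)
open import Relation.Nullary using (yes; no)
open import Relation.Binary.PropositionalEquality as ≡ using (_≡_)
import Algebra.Properties.CommutativeSemigroup as CommutativeSemigroupProperties
import Algebra.Properties.Ring as RingProperties
import Algebra.Solver.Ring as RingSolver
import Relation.Binary.Reasoning.Setoid as SetoidReasoning

-- The obstacle is the clearing of denominators. The coefficient ring is an arbitrary ℚ-algebra,
-- possibly with zero divisors, and `e^c - 1` has constant term 0, so that division by it is
-- impossible in general. What replaces division is that every denominator is a non-zero-divisor,
-- and the generating functions themselves prove it: at x = 0 they say that `e^c - 1` divides c and
-- that `e^a + 1` divides 2. There remain linear forms and positive integers to cancel, which is
-- where rational coefficients enter. A series in two variables is a series in a whose coefficients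
-- are series in b, so that one construction of the series ring, applied twice, serves both cases.
-- The theorem contains two kinds of sums because the divided power of c is treated in two ways. A
-- product with a factor in c or -c absorbs it into that factor, which gives the sums up to m or n;
-- in a product of a series in a and a series in b it is expanded binomially, which gives the sums
-- up to l.

-- The ring of exponential generating functions.

module Hurwitz {c ℓ : Level} (R : CommutativeRing c ℓ) where
  open CommutativeRing R
  open SetoidReasoning setoid
  open CommutativeSemigroupProperties +-commutativeSemigroup using (interchange)

  Series : Set c
  Series = ℕ → Carrier

  infix 4 _≋_
  _≋_ : Series → Series → Set ℓ
  f ≋ g = ∀ n → f n ≈ g n

  ∂ : Series → Series
  ∂ f n = f (suc n)

  infixl 6 _⊞_
  _⊞_ : Series → Series → Series
  (f ⊞ g) n = f n + g n

  ⊟_ : Series → Series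
  (⊟ f) n = - f n

  const : Carrier → Series
  const r zero    = r
  const r (suc n) = 0#

  infixl 7 _⊛_
  -- The Leibniz rule serves as the definition, since differentiation is the shift. The ring laws
  -- then follow by induction on the coefficient with the series left general, and binomial
  -- coefficients appear only when coefficients are extracted.
  _⊛_ : Series → Series → Series
  (f ⊛ g) zero    = f 0 * g 0
  (f ⊛ g) (suc n) = (∂ f ⊛ g) n + (f ⊛ ∂ g) n

  ⊛-cong : ∀ {f f′ g g′} → f ≋ f′ → g ≋ g′ → f ⊛ g ≋ f′ ⊛ g′
  ⊛-cong p q zero    = *-cong (p 0) (q 0)
  ⊛-cong p q (suc n) = +-cong (⊛-cong (λ k → p (suc k)) q n) (⊛-cong p (λ k → q (suc k)) n)

  ⊛-congˡ : ∀ {f g g′} → g ≋ g′ → f ⊛ g ≋ f ⊛ g′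
  ⊛-congˡ = ⊛-cong (λ _ → refl)

  ⊛-congʳ : ∀ {f f′ g} → f ≋ f′ → f ⊛ g ≋ f′ ⊛ g
  ⊛-congʳ p = ⊛-cong p (λ _ → refl)

  ⊛-comm : ∀ f g → f ⊛ g ≋ g ⊛ f
  ⊛-comm f g zero    = *-comm _ _
  ⊛-comm f g (suc n) = trans (+-cong (⊛-comm (∂ f) g n) (⊛-comm f (∂ g) n)) (+-comm _ _)

  ⊛-distribʳ : ∀ h f g → (f ⊞ g) ⊛ h ≋ f ⊛ h ⊞ g ⊛ h
  ⊛-distribʳ h f g zero    = distribʳ _ _ _
  ⊛-distribʳ h f g (suc n) =
    trans (+-cong (⊛-distribʳ h (∂ f) (∂ g) n) (⊛-distribʳ (∂ h) f g n)) (interchange _ _ _ _)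

  ⊛-distribˡ : ∀ h f g → h ⊛ (f ⊞ g) ≋ h ⊛ f ⊞ h ⊛ g
  ⊛-distribˡ h f g zero    = distribˡ _ _ _
  ⊛-distribˡ h f g (suc n) =
    trans (+-cong (⊛-distribˡ (∂ h) f g n) (⊛-distribˡ h (∂ f) (∂ g) n)) (interchange _ _ _ _)

  ⊛-assoc : ∀ f g h → (f ⊛ g) ⊛ h ≋ f ⊛ (g ⊛ h)
  ⊛-assoc f g h zero    = *-assoc _ _ _
  ⊛-assoc f g h (suc n) = begin
    ((∂ f ⊛ g ⊞ f ⊛ ∂ g) ⊛ h) n + ((f ⊛ g) ⊛ ∂ h) n
      ≈⟨ +-cong (⊛-distribʳ h (∂ f ⊛ g) (f ⊛ ∂ g) n) (⊛-assoc f g (∂ h) n) ⟩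
    (((∂ f ⊛ g) ⊛ h) n + ((f ⊛ ∂ g) ⊛ h) n) + (f ⊛ (g ⊛ ∂ h)) n
      ≈⟨ +-congʳ (+-cong (⊛-assoc (∂ f) g h n) (⊛-assoc f (∂ g) h n)) ⟩
    ((∂ f ⊛ (g ⊛ h)) n + (f ⊛ (∂ g ⊛ h)) n) + (f ⊛ (g ⊛ ∂ h)) n
      ≈⟨ +-assoc _ _ _ ⟩
    (∂ f ⊛ (g ⊛ h)) n + ((f ⊛ (∂ g ⊛ h)) n + (f ⊛ (g ⊛ ∂ h)) n)
      ≈⟨ +-congˡ (⊛-distribˡ f (∂ g ⊛ h) (g ⊛ ∂ h) n) ⟨
    (∂ f ⊛ (g ⊛ h)) n + (f ⊛ (∂ g ⊛ h ⊞ g ⊛ ∂ h)) n ∎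

  ⊛-zeroʳ : ∀ f {g} → g ≋ (λ _ → 0#) → f ⊛ g ≋ (λ _ → 0#)
  ⊛-zeroʳ f p zero    = trans (*-congˡ (p 0)) (zeroʳ _)
  ⊛-zeroʳ f p (suc n) =
    trans (+-cong (⊛-zeroʳ (∂ f) p n) (⊛-zeroʳ f (λ k → p (suc k)) n)) (+-identityʳ _)

  -- The hypothesis is a vanishing derivative and not the shape `const r`, so that it also covers a
  -- series in b alone, regarded as a series in a.
  ⊛-constantʳ : ∀ f g → ∂ g ≋ (λ _ → 0#) → f ⊛ g ≋ (λ n → f n * g 0)
  ⊛-constantʳ f g p zero    = refl
  ⊛-constantʳ f g p (suc n) = trans (+-cong (⊛-constantʳ (∂ f) g p n) (⊛-zeroʳ f p n)) (+-identityʳ _)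

  ⊛-const : ∀ f r → f ⊛ const r ≋ (λ n → f n * r)
  ⊛-const f r = ⊛-constantʳ f (const r) (λ _ → refl)

  const-⊛ : ∀ r f → const r ⊛ f ≋ (λ n → r * f n)
  const-⊛ r f n = trans (⊛-comm (const r) f n) (trans (⊛-const f r n) (*-comm _ _))

  ⊛-identityˡ : ∀ f → const 1# ⊛ f ≋ f
  ⊛-identityˡ f n = trans (const-⊛ 1# f n) (*-identityˡ _)

  ⊛-identityʳ : ∀ f → f ⊛ const 1# ≋ f
  ⊛-identityʳ f n = trans (⊛-const f 1# n) (*-identityʳ _)

  scaleˡ-⊛ : ∀ r f g → (λ n → r * f n) ⊛ g ≋ (λ n → r * (f ⊛ g) n)
  scaleˡ-⊛ r f g n =
    trans (⊛-congʳ (λ k → sym (const-⊛ r f k)) n)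
      (trans (⊛-assoc (const r) f g n) (const-⊛ r (f ⊛ g) n))

  scaleʳ-⊛ : ∀ r f g → f ⊛ (λ n → r * g n) ≋ (λ n → r * (f ⊛ g) n)
  scaleʳ-⊛ r f g n =
    trans (⊛-comm f _ n) (trans (scaleˡ-⊛ r g f n) (*-congˡ (⊛-comm g f n)))

  hurwitzRing : CommutativeRing c ℓ
  hurwitzRing = record
    { Carrier = Series
    ; _≈_ = _≋_
    ; _+_ = _⊞_
    ; _*_ = _⊛_
    ; -_ = ⊟_
    ; 0# = λ _ → 0#
    ; 1# = const 1#
    ; isCommutativeRing = record
      { isRing = record
        { +-isAbelianGroup = record
          { isGroup = record
            { isMonoid = record
              { isSemigroup = record
                { isMagma = record
                  { isEquivalence = record
                    { refl = λ _ → refl ; sym = λ p n → sym (p n) ; trans = λ p q n → trans (p n) (q n) }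
                  ; ∙-cong = λ p q n → +-cong (p n) (q n)
                  }
                ; assoc = λ _ _ _ _ → +-assoc _ _ _
                }
              ; identity = (λ _ _ → +-identityˡ _) , (λ _ _ → +-identityʳ _)
              }
            ; inverse = (λ _ _ → -‿inverseˡ _) , (λ _ _ → -‿inverseʳ _)
            ; ⁻¹-cong = λ p n → -‿cong (p n)
            }
          ; comm = λ _ _ _ → +-comm _ _
          }
        ; *-cong = ⊛-cong
        ; *-assoc = ⊛-assoc
        ; *-identity = ⊛-identityˡ , ⊛-identityʳ
        ; distrib = ⊛-distribˡ , ⊛-distribʳ
        }
      ; *-comm = ⊛-comm
      }
    }

  -- The divided power t^l/l!.
  γ : ℕ → Series
  γ zero            = const 1#
  γ (suc l) zero    = 0#
  γ (suc l) (suc n) = γ l n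

-- Cancellation in ℚ-algebras and the two equations with cleared denominators.

RationalHomomorphism : {c ℓ : Level} (S : CommutativeRing c ℓ) → (ℚ → CommutativeRing.Carrier S) → Set ℓ
RationalHomomorphism S ι =
  RingMorphisms.IsRingHomomorphism (CommutativeRing.rawRing +-*-commutativeRing) (CommutativeRing.rawRing S) ι

module ℚ-Algebra {c ℓ : Level} (S : CommutativeRing c ℓ) (ι : ℚ → CommutativeRing.Carrier S)
  (ι-hom : RationalHomomorphism S ι) where
  open CommutativeRing S
  open SetoidReasoning setoid
  open RingMorphisms.IsRingHomomorphism ι-hom public
    using () renaming (+-homo to ι-+; *-homo to ι-*; -‿homo to ι-neg; 0#-homo to ι-0; 1#-homo to ι-1)

  ι-morphism : CommutativeRing.rawRing +-*-commutativeRing -Raw-AlmostCommutative⟶ fromCommutativeRing S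
  ι-morphism = record { ⟦_⟧ = ι ; +-homo = ι-+ ; *-homo = ι-* ; -‿homo = ι-neg ; 0-homo = ι-0 ; 1-homo = ι-1 }

  ι-≟ : (p q : ℚ) → Maybe (ι p ≈ ι q)
  ι-≟ p q with p ℚₚ.≟ q
  ... | yes ≡.refl = just refl
  ... | no _       = nothing

  open RingSolver (CommutativeRing.rawRing +-*-commutativeRing) (fromCommutativeRing S) ι-morphism ι-≟ public
    using (solve; _:+_; _:*_; :-_; _:-_; _:=_)

  -- Non-zero-divisors take the place of invertible elements; a series with constant term 0 such as
  -- `e^c - 1` can be cancelled but in general not inverted.
  Regular : Carrier → Set _
  Regular r = ∀ s → r * s ≈ 0# → s ≈ 0#

  regular-* : ∀ {r s} → Regular r → Regular s → Regular (r * s)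
  regular-* p q t e = q t (p _ (trans (sym (*-assoc _ _ _)) e))

  regular-cong : ∀ {r s} → r ≈ s → Regular r → Regular s
  regular-cong e p t z = p t (trans (*-congʳ e) z)

  -- Regularity passes from a simple multiple (1, 2 or a linear form) to a factor for which it is
  -- not visible directly.
  regular-factor : ∀ u r {s} → u * r ≈ s → Regular s → Regular r
  regular-factor u r {s} e p t z = p t (begin
    s * t       ≈⟨ *-congʳ e ⟨
    u * r * t   ≈⟨ *-assoc _ _ _ ⟩
    u * (r * t) ≈⟨ *-congˡ z ⟩
    u * 0#      ≈⟨ zeroʳ _ ⟩
    0#          ∎)

  cancel : ∀ {r} → Regular r → ∀ s t → r * s ≈ r * t → s ≈ t
  cancel {r} p s t e = begin
    s            ≈⟨ solve 2 (λ s t → s := (s :- t) :+ t) refl s t ⟩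
    (s - t) + t  ≈⟨ +-congʳ (p (s - t) zero′) ⟩
    0# + t       ≈⟨ +-identityˡ t ⟩
    t            ∎
    where
    zero′ : r * (s - t) ≈ 0#
    zero′ = begin
      r * (s - t)   ≈⟨ solve 3 (λ r s t → r :* (s :- t) := r :* s :- r :* t) refl r s t ⟩
      r * s - r * t ≈⟨ +-congʳ e ⟩
      r * t - r * t ≈⟨ -‿inverseʳ _ ⟩
      0#            ∎

  -- Here c = a - b, w = e^c and d, u, v are the denominators e^c - 1, e^a + 1, e^b + 1; in
  -- bernoulli-bernoulli below, u and v are e^a - 1 and e^b - 1.
  bernoulli-euler : ∀ {t c w d u v P Q U V W Z b₁ b₂ e₁ e₂ e₃ e₄} →
    Regular d → Regular u → Regular v →
    b₁ * d ≈ c * P → b₂ * d ≈ c * Q → e₁ * v ≈ t * U → e₂ * u ≈ t * V →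
    e₃ * u ≈ t * W → e₄ * v ≈ t * Z →
    u + d ≈ w * v → P * U ≈ W * Z → Q * V ≈ w * (W * Z) →
    t * (b₁ * e₁ - b₂ * e₂) ≈ - (c * (e₃ * e₄))
  bernoulli-euler {t} {c} {w} {d} {u} {v} {P} {Q} {U} {V} {W} {Z} {b₁} {b₂} {e₁} {e₂} {e₃} {e₄}
    reg-d reg-u reg-v hb₁ hb₂ he₁ he₂ he₃ he₄ hw hPU hQV =
    cancel (regular-* reg-d (regular-* reg-u reg-v)) _ _ (begin
      d * (u * v) * (t * (b₁ * e₁ - b₂ * e₂))
        ≈⟨ solve 8 (λ t d u v b₁ b₂ e₁ e₂ →
             d :* (u :* v) :* (t :* (b₁ :* e₁ :- b₂ :* e₂))
             := t :* ((b₁ :* d) :* (e₁ :* v) :* u :- (b₂ :* d) :* (e₂ :* u) :* v)) refl t d u v b₁ b₂ e₁ e₂ ⟩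
      t * ((b₁ * d) * (e₁ * v) * u - (b₂ * d) * (e₂ * u) * v)
        ≈⟨ *-congˡ (+-cong (*-congʳ (*-cong hb₁ he₁)) (-‿cong (*-congʳ (*-cong hb₂ he₂)))) ⟩
      t * ((c * P) * (t * U) * u - (c * Q) * (t * V) * v)
        ≈⟨ solve 8 (λ t c P Q U V u v →
             t :* ((c :* P) :* (t :* U) :* u :- (c :* Q) :* (t :* V) :* v)
             := t :* t :* c :* ((P :* U) :* u :- (Q :* V) :* v)) refl t c P Q U V u v ⟩
      t * t * c * ((P * U) * u - (Q * V) * v)
        ≈⟨ *-congˡ (+-cong (*-congʳ hPU) (-‿cong (*-congʳ hQV))) ⟩
      t * t * c * ((W * Z) * u - (w * (W * Z)) * v)
        ≈⟨ solve 7 (λ t c w W Z u v →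
             t :* t :* c :* ((W :* Z) :* u :- (w :* (W :* Z)) :* v)
             := t :* t :* c :* (W :* Z) :* (u :- w :* v)) refl t c w W Z u v ⟩
      t * t * c * (W * Z) * (u - w * v)
        -- The relation between the denominators is spent here: `u - w * v` collapses to `- d`,
        -- which supplies the one denominator that the product `e₃ * e₄` does not have.
        ≈⟨ *-congˡ (+-congˡ (-‿cong hw)) ⟨
      t * t * c * (W * Z) * (u - (u + d))
        ≈⟨ solve 6 (λ t c W Z u d →
             t :* t :* c :* (W :* Z) :* (u :- (u :+ d))
             := :- (c :* ((t :* W) :* (t :* Z)) :* d)) refl t c W Z u d ⟩
      - (c * ((t * W) * (t * Z)) * d)
        ≈⟨ -‿cong (*-congʳ (*-congˡ (*-cong he₃ he₄))) ⟨
      - (c * ((e₃ * u) * (e₄ * v)) * d)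
        ≈⟨ solve 6 (λ c d u v e₃ e₄ →
             :- (c :* ((e₃ :* u) :* (e₄ :* v)) :* d)
             := d :* (u :* v) :* (:- (c :* (e₃ :* e₄)))) refl c d u v e₃ e₄ ⟩
      d * (u * v) * (- (c * (e₃ * e₄))) ∎)

  bernoulli-bernoulli : ∀ {a b c w d u v P Q U V W Z b₁ b₂ b₃ b₄ b₅ b₆} →
    Regular d → Regular u → Regular v →
    b₁ * d ≈ c * P → b₂ * d ≈ c * Q → b₃ * v ≈ b * U → b₄ * u ≈ a * V →
    b₅ * u ≈ a * W → b₆ * v ≈ b * Z →
    u ≈ w * v + d → P * U ≈ W * Z → Q * V ≈ w * (W * Z) →
    a * (b₁ * b₃) - b * (b₂ * b₄) ≈ c * (b₅ * b₆)
  bernoulli-bernoulli {a} {b} {c} {w} {d} {u} {v} {P} {Q} {U} {V} {W} {Z} {b₁} {b₂} {b₃} {b₄} {b₅} {b₆}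
    reg-d reg-u reg-v hb₁ hb₂ hb₃ hb₄ hb₅ hb₆ hw hPU hQV =
    cancel (regular-* reg-d (regular-* reg-u reg-v)) _ _ (begin
      d * (u * v) * (a * (b₁ * b₃) - b * (b₂ * b₄))
        ≈⟨ solve 9 (λ a b d u v b₁ b₂ b₃ b₄ →
             d :* (u :* v) :* (a :* (b₁ :* b₃) :- b :* (b₂ :* b₄))
             := a :* ((b₁ :* d) :* (b₃ :* v)) :* u :- b :* ((b₂ :* d) :* (b₄ :* u)) :* v)
             refl a b d u v b₁ b₂ b₃ b₄ ⟩
      a * ((b₁ * d) * (b₃ * v)) * u - b * ((b₂ * d) * (b₄ * u)) * v
        ≈⟨ +-cong (*-congʳ (*-congˡ (*-cong hb₁ hb₃))) (-‿cong (*-congʳ (*-congˡ (*-cong hb₂ hb₄)))) ⟩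
      a * ((c * P) * (b * U)) * u - b * ((c * Q) * (a * V)) * v
        ≈⟨ solve 9 (λ a b c P Q U V u v →
             a :* ((c :* P) :* (b :* U)) :* u :- b :* ((c :* Q) :* (a :* V)) :* v
             := a :* b :* c :* ((P :* U) :* u :- (Q :* V) :* v)) refl a b c P Q U V u v ⟩
      a * b * c * ((P * U) * u - (Q * V) * v)
        ≈⟨ *-congˡ (+-cong (*-cong hPU hw) (-‿cong (*-congʳ hQV))) ⟩
      a * b * c * ((W * Z) * (w * v + d) - (w * (W * Z)) * v)
        ≈⟨ solve 8 (λ a b c w W Z v d →
             a :* b :* c :* ((W :* Z) :* (w :* v :+ d) :- (w :* (W :* Z)) :* v)
             := c :* ((a :* W) :* (b :* Z)) :* d) refl a b c w W Z v d ⟩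
      c * ((a * W) * (b * Z)) * d
        ≈⟨ *-congʳ (*-congˡ (*-cong hb₅ hb₆)) ⟨
      c * ((b₅ * u) * (b₆ * v)) * d
        ≈⟨ solve 6 (λ c d u v b₅ b₆ →
             c :* ((b₅ :* u) :* (b₆ :* v)) :* d
             := d :* (u :* v) :* (c :* (b₅ :* b₆))) refl c d u v b₅ b₆ ⟩
      d * (u * v) * (c * (b₅ * b₆)) ∎)

-- Rational constants and the tables of Bernoulli and Euler numbers.

-- The computation is done with unnormalised fractions, where the reduction to lowest terms
-- disappears.
ℕ→ℚ-+ : ∀ m n → ℕ→ℚ (m ℕ.+ n) ≡ ℕ→ℚ m ℚ.+ ℕ→ℚ n
ℕ→ℚ-+ m n = toℚᵘ-injective (begin
  toℚᵘ (ℕ→ℚ (m ℕ.+ n))                          ≈⟨ toℚᵘ-fromℚᵘ (mkℚᵘ (ℤ.+ (m ℕ.+ n)) 0) ⟩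
  mkℚᵘ (ℤ.+ (m ℕ.+ n)) 0                        ≈⟨ *≡* (≡.cong (ℤ._* ℤ.+ 1) (≡.cong₂ ℤ._+_ (≡.sym (ℤₚ.*-identityʳ (ℤ.+ m))) (≡.sym (ℤₚ.*-identityʳ (ℤ.+ n))))) ⟩
  mkℚᵘ (ℤ.+ m) 0 ℚᵘ.+ mkℚᵘ (ℤ.+ n) 0            ≈⟨ ℚᵘₚ.+-cong (toℚᵘ-fromℚᵘ (mkℚᵘ (ℤ.+ m) 0)) (toℚᵘ-fromℚᵘ (mkℚᵘ (ℤ.+ n) 0)) ⟨
  toℚᵘ (ℕ→ℚ m) ℚᵘ.+ toℚᵘ (ℕ→ℚ n)                ≈⟨ toℚᵘ-homo-+ (ℕ→ℚ m) (ℕ→ℚ n) ⟨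
  toℚᵘ (ℕ→ℚ m ℚ.+ ℕ→ℚ n)                        ∎)
  where open ℚᵘₚ.≃-Reasoning

ℕ→ℚ-* : ∀ m n → ℕ→ℚ (m ℕ.* n) ≡ ℕ→ℚ m ℚ.* ℕ→ℚ n
ℕ→ℚ-* m n = toℚᵘ-injective (begin
  toℚᵘ (ℕ→ℚ (m ℕ.* n))                          ≈⟨ toℚᵘ-fromℚᵘ (mkℚᵘ (ℤ.+ (m ℕ.* n)) 0) ⟩
  mkℚᵘ (ℤ.+ (m ℕ.* n)) 0                        ≈⟨ *≡* (≡.cong (ℤ._* ℤ.+ 1) (ℤₚ.pos-* m n)) ⟩
  mkℚᵘ (ℤ.+ m) 0 ℚᵘ.* mkℚᵘ (ℤ.+ n) 0            ≈⟨ ℚᵘₚ.*-cong (toℚᵘ-fromℚᵘ (mkℚᵘ (ℤ.+ m) 0)) (toℚᵘ-fromℚᵘ (mkℚᵘ (ℤ.+ n) 0)) ⟨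
  toℚᵘ (ℕ→ℚ m) ℚᵘ.* toℚᵘ (ℕ→ℚ n)                ≈⟨ toℚᵘ-homo-* (ℕ→ℚ m) (ℕ→ℚ n) ⟨
  toℚᵘ (ℕ→ℚ m ℚ.* ℕ→ℚ n)                        ∎)
  where open ℚᵘₚ.≃-Reasoning

inv-*-ℕ→ℚ : ∀ n → inv (suc n) ℚ.* ℕ→ℚ (suc n) ≡ ℚ.1ℚ
inv-*-ℕ→ℚ n = toℚᵘ-injective (begin
  toℚᵘ (inv (suc n) ℚ.* ℕ→ℚ (suc n))            ≈⟨ toℚᵘ-homo-* (inv (suc n)) (ℕ→ℚ (suc n)) ⟩
  toℚᵘ (inv (suc n)) ℚᵘ.* toℚᵘ (ℕ→ℚ (suc n))    ≈⟨ ℚᵘₚ.*-cong (toℚᵘ-fromℚᵘ (mkℚᵘ (ℤ.+ 1) n)) (toℚᵘ-fromℚᵘ (mkℚᵘ (ℤ.+ suc n) 0)) ⟩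
  mkℚᵘ (ℤ.+ 1) n ℚᵘ.* mkℚᵘ (ℤ.+ suc n) 0        ≈⟨ *≡* (≡.trans (ℤₚ.*-assoc (ℤ.+ 1) (ℤ.+ suc n) (ℤ.+ 1)) (≡.cong (ℤ.+ 1 ℤ.*_) (≡.sym (ℤₚ.pos-* (suc n) 1)))) ⟩
  toℚᵘ ℚ.1ℚ                                     ∎)
  where open ℚᵘₚ.≃-Reasoning

sumIdx-∷ʳ : ∀ f k xs y → sumIdx f k (xs ++ [ y ]) ≡ sumIdx f k xs ℚ.+ f (k ℕ.+ length xs) y
sumIdx-∷ʳ f k [] y = ≡.trans (ℚₚ.+-comm (f k y) ℚ.0ℚ) (≡.cong (λ i → ℚ.0ℚ ℚ.+ f i y) (≡.sym (ℕₚ.+-identityʳ k)))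
sumIdx-∷ʳ f k (x ∷ xs) y = ≡.trans (≡.cong (f k x ℚ.+_) (sumIdx-∷ʳ f (suc k) xs y))
  (≡.trans (≡.sym (ℚₚ.+-assoc (f k x) _ _))
    (≡.cong (λ i → f k x ℚ.+ sumIdx f (suc k) xs ℚ.+ f i y) (≡.sym (ℕₚ.+-suc k (length xs)))))

nth-∷ʳ : ∀ xs y → nth (xs ++ [ y ]) (length xs) ≡ y
nth-∷ʳ []       y = ≡.refl
nth-∷ʳ (x ∷ xs) y = nth-∷ʳ xs y

length-∷ʳ : ∀ (xs : List ℚ) y → length (xs ++ [ y ]) ≡ suc (length xs)
length-∷ʳ xs y = ≡.trans (length-++ xs) (ℕₚ.+-comm (length xs) 1)

length-bernUpTo : ∀ n → length (bernUpTo n) ≡ suc n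
length-bernUpTo zero    = ≡.refl
length-bernUpTo (suc n) = ≡.trans (length-∷ʳ (bernUpTo n) _) (≡.cong suc (length-bernUpTo n))

length-eulUpTo : ∀ n → length (eulUpTo n) ≡ suc n
length-eulUpTo zero    = ≡.refl
length-eulUpTo (suc n) = ≡.trans (length-∷ʳ (eulUpTo n) _) (≡.cong suc (length-eulUpTo n))

Bern-suc : ∀ n → Bern (suc n) ≡ ℚ.- (inv (suc (suc n)) ℚ.* sumIdx (λ k b → ℕ→ℚ (suc (suc n) C k) ℚ.* b) 0 (bernUpTo n))
Bern-suc n = ≡.trans (≡.cong (nth (bernUpTo (suc n))) (≡.sym (length-bernUpTo n))) (nth-∷ʳ (bernUpTo n) _)

Eul-suc : ∀ n → Eul (suc n) ≡ ℚ.- sumIdx (λ k e → even? (suc n ∸ k) ℚ.* (ℕ→ℚ (suc n C k) ℚ.* e)) 0 (eulUpTo n)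
Eul-suc n = ≡.trans (≡.cong (nth (eulUpTo (suc n))) (≡.sym (length-eulUpTo n))) (nth-∷ʳ (eulUpTo n) _)

-- Peeling off the last entry lets an induction on n turn sums over the table into sums over the
-- numbers `Bern k` themselves.
sumIdx-bernUpTo-suc : ∀ f n → sumIdx f 0 (bernUpTo (suc n)) ≡ sumIdx f 0 (bernUpTo n) ℚ.+ f (suc n) (Bern (suc n))
sumIdx-bernUpTo-suc f n = ≡.trans (sumIdx-∷ʳ f 0 (bernUpTo n) _)
  (≡.cong₂ (λ i b → sumIdx f 0 (bernUpTo n) ℚ.+ f i b) (length-bernUpTo n) (≡.sym (Bern-suc n)))

sumIdx-eulUpTo-suc : ∀ f n → sumIdx f 0 (eulUpTo (suc n)) ≡ sumIdx f 0 (eulUpTo n) ℚ.+ f (suc n) (Eul (suc n))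
sumIdx-eulUpTo-suc f n = ≡.trans (sumIdx-∷ʳ f 0 (eulUpTo n) _)
  (≡.cong₂ (λ i b → sumIdx f 0 (eulUpTo n) ℚ.+ f i b) (length-eulUpTo n) (≡.sym (Eul-suc n)))

-- Finite sums and binomial convolution.

module Sums {c ℓ : Level} (R : CommutativeRing c ℓ) (ι : ℚ → CommutativeRing.Carrier R)
  (ι-hom : RationalHomomorphism R ι) where
  open CommutativeRing R
  open SetoidReasoning setoid
  open Poly R ι public
  open ℚ-Algebra R ι ι-hom public
  open CommutativeSemigroupProperties +-commutativeSemigroup using (interchange)

  nat : ℕ → Carrier
  nat n = ι (ℕ→ℚ n)

  ι-cong : ∀ {p q} → p ≡ q → ι p ≈ ι q
  ι-cong ≡.refl = refl

  nat-+ : ∀ m n → nat (m ℕ.+ n) ≈ nat m + nat n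
  nat-+ m n = trans (ι-cong (ℕ→ℚ-+ m n)) (ι-+ _ _)

  nat-* : ∀ m n → nat (m ℕ.* n) ≈ nat m * nat n
  nat-* m n = trans (ι-cong (ℕ→ℚ-* m n)) (ι-* _ _)

  ι-inv-nat : ∀ n → ι (inv (suc n)) * nat (suc n) ≈ 1#
  ι-inv-nat n = trans (sym (ι-* _ _)) (trans (ι-cong (inv-*-ℕ→ℚ n)) ι-1)

  regular-1# : Regular 1#
  regular-1# s e = trans (sym (*-identityˡ s)) e

  regular-nat-suc : ∀ n → Regular (nat (suc n))
  regular-nat-suc n = regular-factor (ι (inv (suc n))) (nat (suc n)) (ι-inv-nat n) regular-1#

  pascal : ∀ n k → bin (suc n) (suc k) ≈ bin n k + bin n (suc k)
  pascal n k = trans (ι-cong (≡.cong ℕ→ℚ (≡.sym (nCk+nC[k+1]≡[n+1]C[k+1] n k)))) (nat-+ (n C k) (n C suc k))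

  bin-> : ∀ {n k} → n < k → bin n k ≈ 0#
  bin-> {n} {k} n<k = trans (ι-cong (≡.cong ℕ→ℚ (k>n⇒nCk≡0 {n} {k} n<k))) ι-0

  bin-0 : ∀ n → bin n 0 ≈ 1#
  bin-0 n = ι-1

  bin-n : ∀ n → bin n n ≈ 1#
  bin-n n = trans (ι-cong (≡.cong ℕ→ℚ (nCn≡1 n))) ι-1

  sum-shift : ∀ n a f → sumCount n (suc a) f ≡ sumCount n a (λ k → f (suc k))
  sum-shift zero    a f = ≡.refl
  sum-shift (suc n) a f = ≡.cong (f (suc a) +_) (sum-shift n (suc a) f)

  sum : ℕ → (ℕ → Carrier) → Carrier
  sum n f = sumCount n 0 f

  sum-suc : ∀ n f → sum (suc n) f ≈ f 0 + sum n (λ k → f (suc k))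
  sum-suc n f = +-congˡ (reflexive (sum-shift n 0 f))

  sum-cong< : ∀ n {f g} → (∀ k → k < n → f k ≈ g k) → sum n f ≈ sum n g
  sum-cong< zero    p = refl
  sum-cong< (suc n) {f} {g} p = trans (sum-suc n f) (trans
    (+-cong (p 0 (s≤s z≤n)) (sum-cong< n (λ k k<n → p (suc k) (s≤s k<n)))) (sym (sum-suc n g)))

  sum-cong : ∀ n {f g} → (∀ k → f k ≈ g k) → sum n f ≈ sum n g
  sum-cong n p = sum-cong< n (λ k _ → p k)

  sum-+ : ∀ n f g → sum n (λ k → f k + g k) ≈ sum n f + sum n g
  sum-+ zero    f g = sym (+-identityˡ 0#)
  sum-+ (suc n) f g = begin
    sum (suc n) (λ k → f k + g k)                                  ≈⟨ sum-suc n (λ k → f k + g k) ⟩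
    (f 0 + g 0) + sum n (λ k → f (suc k) + g (suc k))              ≈⟨ +-congˡ (sum-+ n (λ k → f (suc k)) (λ k → g (suc k))) ⟩
    (f 0 + g 0) + (sum n (λ k → f (suc k)) + sum n (λ k → g (suc k))) ≈⟨ interchange _ _ _ _ ⟩
    (f 0 + sum n (λ k → f (suc k))) + (g 0 + sum n (λ k → g (suc k))) ≈⟨ +-cong (sum-suc n f) (sum-suc n g) ⟨
    sum (suc n) f + sum (suc n) g                                  ∎

  sum-*ˡ : ∀ r n f → sum n (λ k → r * f k) ≈ r * sum n f
  sum-*ˡ r zero    f = sym (zeroʳ r)
  sum-*ˡ r (suc n) f = begin
    sum (suc n) (λ k → r * f k)               ≈⟨ sum-suc n (λ k → r * f k) ⟩
    r * f 0 + sum n (λ k → r * f (suc k))     ≈⟨ +-congˡ (sum-*ˡ r n (λ k → f (suc k))) ⟩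
    r * f 0 + r * sum n (λ k → f (suc k))     ≈⟨ distribˡ _ _ _ ⟨
    r * (f 0 + sum n (λ k → f (suc k)))       ≈⟨ *-congˡ (sum-suc n f) ⟨
    r * sum (suc n) f                         ∎

  sum-last : ∀ n f → sum (suc n) f ≈ sum n f + f n
  sum-last zero    f = +-comm _ _
  sum-last (suc n) f = begin
    sum (suc (suc n)) f                       ≈⟨ sum-suc (suc n) f ⟩
    f 0 + sum (suc n) (λ k → f (suc k))       ≈⟨ +-congˡ (sum-last n (λ k → f (suc k))) ⟩
    f 0 + (sum n (λ k → f (suc k)) + f (suc n)) ≈⟨ +-assoc _ _ _ ⟨
    f 0 + sum n (λ k → f (suc k)) + f (suc n) ≈⟨ +-congʳ (sum-suc n f) ⟨
    sum (suc n) f + f (suc n)                 ∎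

  sum-truncate : ∀ n d f → (∀ k → n ≤ k → f k ≈ 0#) → sum (n ℕ.+ d) f ≈ sum n f
  sum-truncate n zero    f p = reflexive (≡.cong (λ i → sum i f) (ℕₚ.+-identityʳ n))
  sum-truncate n (suc d) f p = begin
    sum (n ℕ.+ suc d) f           ≡⟨ ≡.cong (λ i → sum i f) (ℕₚ.+-suc n d) ⟩
    sum (suc (n ℕ.+ d)) f         ≈⟨ sum-last (n ℕ.+ d) f ⟩
    sum (n ℕ.+ d) f + f (n ℕ.+ d) ≈⟨ +-cong (sum-truncate n d f p) (p (n ℕ.+ d) (ℕₚ.m≤m+n n d)) ⟩
    sum n f + 0#                  ≈⟨ +-identityʳ _ ⟩
    sum n f                       ∎

  binomialSum : ℕ → (ℕ → ℕ → Carrier) → Carrier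
  binomialSum n F = sum (suc n) (λ k → bin n k * F k (n ∸ k))

  binomialSum-zero : ∀ F → binomialSum 0 F ≈ F 0 0
  binomialSum-zero F = trans (+-identityʳ _) (trans (*-congʳ (bin-0 0)) (*-identityˡ _))

  -- Pascal's rule in the shape of the Leibniz recursion: raising the first or the second index of F
  -- corresponds to differentiating the left or the right factor of a product.
  binomialSum-suc : ∀ n F → binomialSum (suc n) F ≈ binomialSum n (λ i j → F (suc i) j) + binomialSum n (λ i j → F i (suc j))
  binomialSum-suc n F = begin
    binomialSum (suc n) F
      ≈⟨ sum-suc (suc n) (λ k → bin (suc n) k * F k (suc n ∸ k)) ⟩
    bin (suc n) 0 * F 0 (suc n) + sum (suc n) (λ k → bin (suc n) (suc k) * F (suc k) (n ∸ k))
      ≈⟨ +-cong (*-congʳ (trans (bin-0 (suc n)) (sym (bin-0 n))))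
           (trans (sum-cong (suc n) (λ k → trans (*-congʳ (pascal n k)) (distribʳ _ _ _)))
             (sum-+ (suc n) (λ k → bin n k * F (suc k) (n ∸ k)) (λ k → bin n (suc k) * F (suc k) (n ∸ k)))) ⟩
    bin n 0 * F 0 (suc n) + (A + sum (suc n) (λ k → bin n (suc k) * F (suc k) (n ∸ k)))
      -- The term k = n is removed, its binomial coefficient being zero, because `n ∸ k` equals
      -- `suc (n ∸ suc k)` only for k < n.
      ≈⟨ +-congˡ (+-congˡ (trans (sum-last n _)
           (trans (+-congˡ (trans (*-congʳ (bin-> (ℕₚ.n<1+n n))) (zeroˡ _))) (+-identityʳ _)))) ⟩
    bin n 0 * F 0 (suc n) + (A + sum n (λ k → bin n (suc k) * F (suc k) (n ∸ k)))
      ≈⟨ +-congˡ (+-congˡ (sum-cong< n (λ k k<n → *-congˡ (reflexive (≡.cong (F (suc k)) (ℕₚ.+-∸-assoc 1 k<n)))))) ⟩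
    bin n 0 * F 0 (suc n) + (A + B)
      ≈⟨ x∙yz≈y∙xz _ _ _ ⟩
    A + (bin n 0 * F 0 (suc n) + B)
      ≈⟨ +-congˡ (sum-suc n (λ k → bin n k * F k (suc (n ∸ k)))) ⟨
    A + binomialSum n (λ i j → F i (suc j)) ∎
    where
    open CommutativeSemigroupProperties +-commutativeSemigroup using (x∙yz≈y∙xz)
    A B : Carrier
    A = binomialSum n (λ i j → F (suc i) j)
    B = sum n (λ k → bin n (suc k) * F (suc k) (suc (n ∸ suc k)))

  open Hurwitz R public

  ⊛-binomialSum : ∀ f g n → (f ⊛ g) n ≈ binomialSum n (λ i j → f i * g j)
  ⊛-binomialSum f g zero    = sym (binomialSum-zero (λ i j → f i * g j))
  ⊛-binomialSum f g (suc n) =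
    trans (+-cong (⊛-binomialSum (∂ f) g n) (⊛-binomialSum f (∂ g) n)) (sym (binomialSum-suc n (λ i j → f i * g j)))

  -- This product is the source of the theorem's binomial coefficients with l in the lower index.
  γ-⊛ : ∀ p f n → (γ p ⊛ f) n ≈ bin n p * f (n ∸ p)
  γ-⊛ zero    f n = trans (⊛-identityˡ f n) (sym (trans (*-congʳ (bin-0 n)) (*-identityˡ _)))
  γ-⊛ (suc p) f zero = trans (zeroˡ _) (sym (trans (*-congʳ (bin-> {0} {suc p} (s≤s z≤n))) (zeroˡ _)))
  γ-⊛ (suc p) f (suc n) = begin
    (γ p ⊛ f) n + (γ (suc p) ⊛ ∂ f) n                            ≈⟨ +-cong (γ-⊛ p f n) (γ-⊛ (suc p) (∂ f) n) ⟩
    bin n p * f (n ∸ p) + bin n (suc p) * f (suc (n ∸ suc p))     ≈⟨ +-congˡ (last (ℕₚ.≤-<-connex n p)) ⟩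
    bin n p * f (n ∸ p) + bin n (suc p) * f (n ∸ p)               ≈⟨ distribʳ _ _ _ ⟨
    (bin n p + bin n (suc p)) * f (n ∸ p)                        ≈⟨ *-congʳ (pascal n p) ⟨
    bin (suc n) (suc p) * f (n ∸ p)                              ∎
    where
    -- For n ≤ p the two truncated indices differ, but the binomial coefficient in front of both is
    -- zero.
    last : n ≤ p ⊎ p < n → bin n (suc p) * f (suc (n ∸ suc p)) ≈ bin n (suc p) * f (n ∸ p)
    last (inj₁ n≤p) = trans (trans (*-congʳ (bin-> (s≤s n≤p))) (zeroˡ _)) (sym (trans (*-congʳ (bin-> (s≤s n≤p))) (zeroˡ _)))
    last (inj₂ p<n) = *-congˡ (reflexive (≡.cong f (≡.sym (ℕₚ.+-∸-assoc 1 p<n))))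

-- Applied once and then twice, this makes the series in one and in two variables ℚ-algebras, so
-- that the solver and the cancellation lemmas are available at every level.
const-homomorphism : {c ℓ : Level} (R : CommutativeRing c ℓ) (ι : ℚ → CommutativeRing.Carrier R) →
  RationalHomomorphism R ι → RationalHomomorphism (Hurwitz.hurwitzRing R) (λ r → Hurwitz.const R (ι r))
const-homomorphism R ι ι-hom = record
  { isSemiringHomomorphism = record
    { isNearSemiringHomomorphism = record
      { +-isMonoidHomomorphism = record
        { isMagmaHomomorphism = record
          { isRelHomomorphism = record { cong = λ { ≡.refl _ → refl } }
          ; homo = λ p q → λ { zero → ι-+ p q ; (suc n) → sym (+-identityˡ 0#) }
          }
        ; ε-homo = λ { zero → ι-0 ; (suc n) → refl }
        }
      ; *-homo = λ p q n → trans (const-* p q n) (sym (const-⊛ (ι p) (const (ι q)) n))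
      }
    ; 1#-homo = λ { zero → ι-1 ; (suc n) → refl }
    }
  ; -‿homo = λ p → λ { zero → ι-neg p ; (suc n) → sym -0#≈0# }
  }
  where
  open CommutativeRing R
  open Hurwitz R
  open ℚ-Algebra R ι ι-hom
  open RingProperties ring using (-0#≈0#)
  const-* : ∀ p q → const (ι (p ℚ.* q)) ≋ (λ n → ι p * const (ι q) n)
  const-* p q zero    = ι-* p q
  const-* p q (suc n) = sym (zeroʳ _)

-- Generating functions of the Bernoulli and Euler polynomials.

module AppellSeries {c ℓ : Level} (R : CommutativeRing c ℓ) (ι : ℚ → CommutativeRing.Carrier R)
  (ι-hom : RationalHomomorphism R ι) where
  open CommutativeRing R
  open SetoidReasoning setoid
  open Sums R ι ι-hom public
  open RingProperties ring using (-‿distribʳ-*; -1*x≈-x; -‿involutive)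
  open CommutativeSemigroupProperties *-commutativeSemigroup using () renaming (interchange to *-interchange; x∙yz≈y∙xz to *-leftSwap)
  private
    module H where
      open CommutativeRing hurwitzRing public
      open SetoidReasoning (CommutativeRing.setoid hurwitzRing) public
    module HA = ℚ-Algebra hurwitzRing (λ r → const (ι r)) (const-homomorphism R ι ι-hom)

  pow-cong : ∀ {x y} → x ≈ y → ∀ n → pow x n ≈ pow y n
  pow-cong p zero    = refl
  pow-cong p (suc n) = *-cong p (pow-cong p n)

  pow-+ : ∀ x m n → pow x (m ℕ.+ n) ≈ pow x m * pow x n
  pow-+ x zero    n = sym (*-identityˡ _)
  pow-+ x (suc m) n = trans (*-congˡ (pow-+ x m n)) (sym (*-assoc _ _ _))

  pow-* : ∀ x y n → pow (x * y) n ≈ pow x n * pow y n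
  pow-* x y zero    = sym (*-identityˡ 1#)
  pow-* x y (suc n) = trans (*-congˡ (pow-* x y n)) (*-interchange _ _ _ _)

  pow-1# : ∀ n → pow 1# n ≈ 1#
  pow-1# zero    = refl
  pow-1# (suc n) = trans (*-identityˡ _) (pow-1# n)

  exp : Carrier → Series
  exp x n = pow x n

  exp-cong : ∀ {x y} → x ≈ y → exp x ≋ exp y
  exp-cong = pow-cong

  exp-⊛ : ∀ x y → exp x ⊛ exp y ≋ exp (x + y)
  exp-⊛ x y zero    = *-identityˡ 1#
  exp-⊛ x y (suc n) = begin
    (∂ (exp x) ⊛ exp y) n + (exp x ⊛ ∂ (exp y)) n ≈⟨ +-cong (scaleˡ-⊛ x (exp x) (exp y) n) (scaleʳ-⊛ y (exp x) (exp y) n) ⟩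
    x * (exp x ⊛ exp y) n + y * (exp x ⊛ exp y) n ≈⟨ distribʳ _ _ _ ⟨
    (x + y) * (exp x ⊛ exp y) n                   ≈⟨ *-congˡ (exp-⊛ x y n) ⟩
    (x + y) * exp (x + y) n                       ∎

  exp-0# : exp 0# ≋ const 1#
  exp-0# zero    = refl
  exp-0# (suc n) = zeroˡ _

  scale : Carrier → Series → Series
  scale t f n = pow t n * f n

  scale-cong : ∀ t {f g} → f ≋ g → scale t f ≋ scale t g
  scale-cong t p n = *-congˡ (p n)

  scale-⊞ : ∀ t f g → scale t (f ⊞ g) ≋ scale t f ⊞ scale t g
  scale-⊞ t f g n = distribˡ _ _ _

  scale-⊛ : ∀ t f g → scale t (f ⊛ g) ≋ scale t f ⊛ scale t g
  scale-⊛ t f g zero    = trans (*-identityˡ _) (sym (*-cong (*-identityˡ _) (*-identityˡ _)))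
  scale-⊛ t f g (suc n) = begin
    t * pow t n * ((∂ f ⊛ g) n + (f ⊛ ∂ g) n)
      ≈⟨ trans (*-assoc _ _ _) (*-congˡ (distribˡ _ _ _)) ⟩
    t * (scale t (∂ f ⊛ g) n + scale t (f ⊛ ∂ g) n)
      ≈⟨ *-congˡ (+-cong (scale-⊛ t (∂ f) g n) (scale-⊛ t f (∂ g) n)) ⟩
    t * ((scale t (∂ f) ⊛ scale t g) n + (scale t f ⊛ scale t (∂ g)) n)
      ≈⟨ distribˡ _ _ _ ⟩
    t * (scale t (∂ f) ⊛ scale t g) n + t * (scale t f ⊛ scale t (∂ g)) n
      ≈⟨ +-cong (scaleˡ-⊛ t (scale t (∂ f)) (scale t g) n) (scaleʳ-⊛ t (scale t f) (scale t (∂ g)) n) ⟨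
    ((λ k → t * scale t (∂ f) k) ⊛ scale t g) n + (scale t f ⊛ (λ k → t * scale t (∂ g) k)) n
      ≈⟨ +-cong (⊛-congʳ (λ k → sym (*-assoc _ _ _)) n) (⊛-congˡ {scale t f} (λ k → sym (*-assoc _ _ _)) n) ⟩
    (∂ (scale t f) ⊛ scale t g) n + (scale t f ⊛ ∂ (scale t g)) n ∎

  scale-const : ∀ t r → scale t (const r) ≋ const r
  scale-const t r zero    = *-identityˡ r
  scale-const t r (suc n) = zeroʳ _

  bern : Series
  bern n = ι (Bern n)

  eul : Series
  eul n = ι (Eul n)

  ι-sumIdx-bernUpTo : ∀ M n → ι (sumIdx (λ k b → ℕ→ℚ (M C k) ℚ.* b) 0 (bernUpTo n)) ≈ sum (suc n) (λ k → bin M k * bern k)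
  ι-sumIdx-bernUpTo M zero    = trans (ι-+ (ℕ→ℚ (M C 0) ℚ.* ℚ.1ℚ) ℚ.0ℚ) (+-cong (ι-* (ℕ→ℚ (M C 0)) ℚ.1ℚ) ι-0)
  ι-sumIdx-bernUpTo M (suc n) = begin
    ι (sumIdx f 0 (bernUpTo (suc n)))                       ≈⟨ ι-cong (sumIdx-bernUpTo-suc f n) ⟩
    ι (sumIdx f 0 (bernUpTo n) ℚ.+ f (suc n) (Bern (suc n))) ≈⟨ ι-+ _ _ ⟩
    ι (sumIdx f 0 (bernUpTo n)) + ι (f (suc n) (Bern (suc n)))
      ≈⟨ +-cong (ι-sumIdx-bernUpTo M n) (ι-* (ℕ→ℚ (M C suc n)) (Bern (suc n))) ⟩
    sum (suc n) g + g (suc n)                               ≈⟨ sum-last (suc n) g ⟨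
    sum (suc (suc n)) g                                     ∎
    where
    f : ℕ → ℚ → ℚ
    f k b = ℕ→ℚ (M C k) ℚ.* b
    g : ℕ → Carrier
    g k = bin M k * bern k

  -- The last summand carries the factor `N C suc n`, which is N and cancels the 1/N in the
  -- definition of `Bern`.
  bernoulli-recurrence : ∀ n → sum (suc (suc n)) (λ k → bin (suc (suc n)) k * bern k) ≈ 0#
  bernoulli-recurrence n = begin
    sum (suc (suc n)) g                       ≈⟨ sum-last (suc n) g ⟩
    s + bin N (suc n) * bern (suc n)
      ≈⟨ +-congˡ (*-cong (ι-cong (≡.cong ℕ→ℚ N-C)) (trans (ι-cong (Bern-suc n)) (trans (ι-neg _) (-‿cong (ι-* _ _))))) ⟩
    s + nat N * - (ι (inv N) * ι (sumIdx (λ k b → ℕ→ℚ (N C k) ℚ.* b) 0 (bernUpTo n)))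
      ≈⟨ +-congˡ (*-congˡ (-‿cong (*-congˡ (ι-sumIdx-bernUpTo N n)))) ⟩
    s + nat N * - (ι (inv N) * s)
      ≈⟨ solve 3 (λ s N i → s :+ N :* (:- (i :* s)) := s :+ :- ((i :* N) :* s)) refl s (nat N) (ι (inv N)) ⟩
    s + - ((ι (inv N) * nat N) * s)           ≈⟨ +-congˡ (-‿cong (trans (*-congʳ (ι-inv-nat (suc n))) (*-identityˡ s))) ⟩
    s + - s                                   ≈⟨ -‿inverseʳ s ⟩
    0#                                        ∎
    where
    N : ℕ
    N = suc (suc n)
    g : ℕ → Carrier
    g k = bin N k * bern k
    s : Carrier
    s = sum (suc n) g
    N-C : N C suc n ≡ N
    N-C = ≡.trans (nCk≡nC[n∸k] {suc n} {N} (ℕₚ.n≤1+n _))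
      (≡.trans (≡.cong (N C_) (ℕₚ.m+n∸n≡m 1 (suc n))) (nC1≡n N))

  bern-exp : bern ⊛ exp 1# ≋ bern ⊞ γ 1
  bern-exp n = begin
    (bern ⊛ exp 1#) n                              ≈⟨ ⊛-binomialSum bern (exp 1#) n ⟩
    binomialSum n (λ i j → bern i * pow 1# j)      ≈⟨ sum-cong (suc n) (λ k → *-congˡ (trans (*-congˡ (pow-1# (n ∸ k))) (*-identityʳ _))) ⟩
    sum (suc n) (λ k → bin n k * bern k)           ≈⟨ sum-last n (λ k → bin n k * bern k) ⟩
    sum n (λ k → bin n k * bern k) + bin n n * bern n ≈⟨ +-cong (lower n) (trans (*-congʳ (bin-n n)) (*-identityˡ _)) ⟩
    γ 1 n + bern n                                 ≈⟨ +-comm _ _ ⟩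
    bern n + γ 1 n                                 ∎
    where
    -- The recurrence starts at n = 2. At n = 1 the sum is B_0 = 1, and this exception is the
    -- summand t of the functional equation.
    lower : ∀ n → sum n (λ k → bin n k * bern k) ≈ γ 1 n
    lower zero          = refl
    lower (suc zero)    = trans (+-identityʳ _) (trans (*-cong (bin-0 1) ι-1) (*-identityˡ 1#))
    lower (suc (suc n)) = bernoulli-recurrence n

  -- The parity condition in the Euler recurrence is the coefficient sequence of the hyperbolic
  -- cosine, so that the recurrence says that `eul` is its reciprocal.
  cosh : Series
  cosh n = ι (even? n)

  cosh-exp : cosh ⊞ cosh ≋ exp 1# ⊞ exp (- 1#)
  cosh-exp zero          = +-cong ι-1 ι-1
  cosh-exp (suc zero)    = trans (+-cong ι-0 ι-0) (trans (+-identityˡ 0#)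
    (sym (trans (+-cong (*-identityʳ _) (*-identityʳ _)) (-‿inverseʳ 1#))))
  cosh-exp (suc (suc n)) = trans (cosh-exp n) (+-cong
    (sym (trans (*-identityˡ _) (*-identityˡ _)))
    (sym (trans (-1*x≈-x _) (trans (-‿cong (-1*x≈-x _)) (-‿involutive _)))))

  ι-sumIdx-eulUpTo : ∀ M n → ι (sumIdx (λ k e → even? (M ∸ k) ℚ.* (ℕ→ℚ (M C k) ℚ.* e)) 0 (eulUpTo n))
                             ≈ sum (suc n) (λ k → bin M k * (eul k * cosh (M ∸ k)))
  ι-sumIdx-eulUpTo M n = begin
    ι (sumIdx f 0 (eulUpTo n)) ≈⟨ image n ⟩
    sum (suc n) (λ k → ι (f k (Eul k)))
      ≈⟨ sum-cong (suc n) (λ k → trans (ι-* (even? (M ∸ k)) (ℕ→ℚ (M C k) ℚ.* Eul k)) (trans (*-congˡ (ι-* (ℕ→ℚ (M C k)) (Eul k)))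
           (trans (*-leftSwap _ _ _) (*-congˡ (*-comm _ _))))) ⟩
    sum (suc n) (λ k → bin M k * (eul k * cosh (M ∸ k))) ∎
    where
    f : ℕ → ℚ → ℚ
    f k e = even? (M ∸ k) ℚ.* (ℕ→ℚ (M C k) ℚ.* e)
    image : ∀ n → ι (sumIdx f 0 (eulUpTo n)) ≈ sum (suc n) (λ k → ι (f k (Eul k)))
    image zero    = trans (ι-+ (f 0 ℚ.1ℚ) ℚ.0ℚ) (+-congˡ ι-0)
    image (suc n) = begin
      ι (sumIdx f 0 (eulUpTo (suc n)))                       ≈⟨ ι-cong (sumIdx-eulUpTo-suc f n) ⟩
      ι (sumIdx f 0 (eulUpTo n) ℚ.+ f (suc n) (Eul (suc n)))  ≈⟨ ι-+ _ _ ⟩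
      ι (sumIdx f 0 (eulUpTo n)) + ι (f (suc n) (Eul (suc n))) ≈⟨ +-congʳ (image n) ⟩
      sum (suc n) (λ k → ι (f k (Eul k))) + ι (f (suc n) (Eul (suc n))) ≈⟨ sum-last (suc n) (λ k → ι (f k (Eul k))) ⟨
      sum (suc (suc n)) (λ k → ι (f k (Eul k)))               ∎

  eul-cosh : eul ⊛ cosh ≋ const 1#
  eul-cosh zero    = trans (*-cong ι-1 ι-1) (*-identityˡ 1#)
  eul-cosh (suc n) = begin
    (eul ⊛ cosh) N ≈⟨ ⊛-binomialSum eul cosh N ⟩
    sum (suc N) g  ≈⟨ sum-last N g ⟩
    sum N g + g N
      ≈⟨ +-cong (sym (ι-sumIdx-eulUpTo N n)) (trans (*-congʳ (bin-n N)) (trans (*-identityˡ _)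
           (*-cong (trans (ι-cong (Eul-suc n)) (ι-neg _)) (trans (ι-cong (≡.cong even? (ℕₚ.n∸n≡0 n))) ι-1)))) ⟩
    ι s + - ι s * 1# ≈⟨ +-congˡ (*-identityʳ _) ⟩
    ι s + - ι s    ≈⟨ -‿inverseʳ _ ⟩
    0#             ∎
    where
    N : ℕ
    N = suc n
    g : ℕ → Carrier
    g k = bin N k * (eul k * cosh (N ∸ k))
    s : ℚ
    s = sumIdx (λ k e → even? (N ∸ k) ℚ.* (ℕ→ℚ (N C k) ℚ.* e)) 0 (eulUpTo n)

  ½ : Carrier
  ½ = ι (ℤ.+ 1 ℚ./ 2)

  ½+½ : ½ + ½ ≈ 1#
  ½+½ = trans (sym (ι-+ _ _)) ι-1

  ι-inv2^ : ∀ n → ι (inv2^ n) ≈ pow ½ n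
  ι-inv2^ zero    = ι-1
  ι-inv2^ (suc n) = trans (ι-* (ℤ.+ 1 ℚ./ 2) (inv2^ n)) (*-congˡ (ι-inv2^ n))

  two : Series
  two = H.1# H.+ H.1#

  -- By the powers of 2 in the Euler polynomials `scale ½ eul` is sech(t/2), and `e^t + 1` is
  -- `e^(t/2)` times 2 cosh(t/2). The remaining `e^(t/2)` later compensates the shift in `x - ½`.
  eul-½-exp : scale ½ eul ⊛ (exp 1# ⊞ H.1#) ≋ two ⊛ exp ½
  eul-½-exp = H.begin
    scale ½ eul ⊛ (exp 1# ⊞ H.1#)
      H.≈⟨ H.*-congˡ {scale ½ eul} (H.+-cong (exp-cong ½+½) (λ n → trans (exp-cong (-‿inverseʳ ½) n) (exp-0# n))) ⟨
    scale ½ eul ⊛ (exp (½ + ½) ⊞ exp (½ + - ½))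
      H.≈⟨ H.*-congˡ {scale ½ eul} (H.+-cong (exp-⊛ ½ ½) (exp-⊛ ½ (- ½))) ⟨
    scale ½ eul ⊛ (exp ½ ⊛ exp ½ ⊞ exp ½ ⊛ exp (- ½))
      H.≈⟨ H.*-congˡ {scale ½ eul} (H.distribˡ (exp ½) (exp ½) (exp (- ½))) ⟨
    scale ½ eul ⊛ (exp ½ ⊛ (exp ½ ⊞ exp (- ½)))
      H.≈⟨ H.*-congˡ {scale ½ eul} (H.*-congˡ {exp ½} scale-cosh) ⟨
    scale ½ eul ⊛ (exp ½ ⊛ (scale ½ cosh ⊞ scale ½ cosh))
      H.≈⟨ HA.solve 3 (λ e x c → e HA.:* (x HA.:* (c HA.:+ c)) HA.:= (e HA.:* c HA.:+ e HA.:* c) HA.:* x) H.refl (scale ½ eul) (exp ½) (scale ½ cosh) ⟩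
    (scale ½ eul ⊛ scale ½ cosh ⊞ scale ½ eul ⊛ scale ½ cosh) ⊛ exp ½
      H.≈⟨ H.*-congʳ {exp ½} (H.+-cong inverse inverse) ⟩
    two ⊛ exp ½ H.∎
    where
    inverse : scale ½ eul ⊛ scale ½ cosh ≋ const 1#
    inverse n = trans (sym (scale-⊛ ½ eul cosh n)) (trans (scale-cong ½ eul-cosh n) (scale-const ½ 1# n))
    scale-cosh : scale ½ cosh ⊞ scale ½ cosh ≋ exp ½ ⊞ exp (- ½)
    scale-cosh n = begin
      scale ½ cosh n + scale ½ cosh n        ≈⟨ distribˡ _ _ _ ⟨
      pow ½ n * (cosh n + cosh n)            ≈⟨ *-congˡ (cosh-exp n) ⟩
      pow ½ n * (pow 1# n + pow (- 1#) n)    ≈⟨ distribˡ _ _ _ ⟩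
      pow ½ n * pow 1# n + pow ½ n * pow (- 1#) n ≈⟨ +-cong (pow-* ½ 1# n) (pow-* ½ (- 1#) n) ⟨
      pow (½ * 1#) n + pow (½ * - 1#) n
        ≈⟨ +-cong (pow-cong (*-identityʳ ½) n) (pow-cong (trans (sym (-‿distribʳ-* ½ 1#)) (-‿cong (*-identityʳ ½))) n) ⟩
      pow ½ n + pow (- ½) n                  ∎

  BPs EPs : Carrier → Series
  BPs x n = BP n x
  EPs x n = EP n x

  BPs-⊛ : ∀ x → BPs x ≋ bern ⊛ exp x
  BPs-⊛ x n = sym (⊛-binomialSum bern (exp x) n)

  EPs-⊛ : ∀ x → EPs x ≋ scale ½ eul ⊛ exp (x - ½)
  EPs-⊛ x n = trans
    (sum-cong (suc n) (λ k → *-congˡ (*-congʳ (trans (ι-* (Eul k) (inv2^ k)) (trans (*-congˡ (ι-inv2^ k)) (*-comm _ _))))))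
    (sym (⊛-binomialSum (scale ½ eul) (exp (x - ½)) n))

  BPs-exp : ∀ x → BPs x ⊛ (exp 1# H.- H.1#) ≋ γ 1 ⊛ exp x
  BPs-exp x = H.begin
    BPs x ⊛ (exp 1# H.- H.1#)
      H.≈⟨ H.*-congʳ {exp 1# H.- H.1#} (BPs-⊛ x) ⟩
    bern ⊛ exp x ⊛ (exp 1# H.- H.1#)
      H.≈⟨ HA.solve 4 (λ b x e u → b HA.:* x HA.:* (e HA.:- u) HA.:= (b HA.:* e HA.:- b HA.:* u) HA.:* x) H.refl bern (exp x) (exp 1#) H.1# ⟩
    (bern ⊛ exp 1# H.- bern ⊛ H.1#) ⊛ exp x
      H.≈⟨ H.*-congʳ {exp x} (H.+-cong bern-exp (H.-‿cong (H.*-identityʳ bern))) ⟩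
    (bern ⊞ γ 1 H.- bern) ⊛ exp x
      H.≈⟨ HA.solve 3 (λ b g x → (b HA.:+ g HA.:- b) HA.:* x HA.:= g HA.:* x) H.refl bern (γ 1) (exp x) ⟩
    γ 1 ⊛ exp x H.∎

  EPs-exp : ∀ x → EPs x ⊛ (exp 1# ⊞ H.1#) ≋ two ⊛ exp x
  EPs-exp x = H.begin
    EPs x ⊛ (exp 1# ⊞ H.1#)
      H.≈⟨ H.*-congʳ {exp 1# ⊞ H.1#} (EPs-⊛ x) ⟩
    scale ½ eul ⊛ exp (x - ½) ⊛ (exp 1# ⊞ H.1#)
      H.≈⟨ HA.solve 3 (λ a b c → a HA.:* b HA.:* c HA.:= a HA.:* c HA.:* b) H.refl (scale ½ eul) (exp (x - ½)) (exp 1# ⊞ H.1#) ⟩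
    scale ½ eul ⊛ (exp 1# ⊞ H.1#) ⊛ exp (x - ½)
      H.≈⟨ H.*-congʳ {exp (x - ½)} eul-½-exp ⟩
    two ⊛ exp ½ ⊛ exp (x - ½)
      H.≈⟨ H.*-assoc two (exp ½) (exp (x - ½)) ⟩
    two ⊛ (exp ½ ⊛ exp (x - ½))
      H.≈⟨ H.*-congˡ {two} (exp-⊛ ½ (x - ½)) ⟩
    two ⊛ exp (½ + (x - ½))
      H.≈⟨ H.*-congˡ {two} (exp-cong (solve 2 (λ h x → h :+ (x :- h) := x) refl ½ x)) ⟩
    two ⊛ exp x H.∎

-- Substitution of linear forms into series, in two variables.

module Bivariate {c ℓ : Level} (R : CommutativeRing c ℓ) (ι : ℚ → CommutativeRing.Carrier R)
  (ι-hom : RationalHomomorphism R ι) where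
  open CommutativeRing R
  open SetoidReasoning setoid
  open AppellSeries R ι ι-hom public
  open RingProperties ring using (-‿distribʳ-*; -1*x≈-x)
  open CommutativeSemigroupProperties *-commutativeSemigroup using () renaming (x∙yz≈y∙xz to *-leftSwap)

  module B = Hurwitz hurwitzRing
  module S where
    open CommutativeRing B.hurwitzRing public
    open SetoidReasoning (CommutativeRing.setoid B.hurwitzRing) public
  module BS = Sums hurwitzRing (λ r → const (ι r)) (const-homomorphism R ι ι-hom)
  module SA = ℚ-Algebra B.hurwitzRing (λ r → B.const (const (ι r)))
    (const-homomorphism hurwitzRing (λ r → const (ι r)) (const-homomorphism R ι ι-hom))

  scaleˡ-⊛₂ : ∀ r F G i j → ((λ i j → r * F i j) B.⊛ G) i j ≈ r * (F B.⊛ G) i j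
  scaleˡ-⊛₂ r F G i j = begin
    ((λ i j → r * F i j) B.⊛ G) i j         ≈⟨ B.⊛-congʳ {g = G} (λ i j → const-⊛ r (F i) j) i j ⟨
    ((λ i → const r ⊛ F i) B.⊛ G) i j       ≈⟨ B.scaleˡ-⊛ (const r) F G i j ⟩
    (const r ⊛ (F B.⊛ G) i) j               ≈⟨ const-⊛ r ((F B.⊛ G) i) j ⟩
    r * (F B.⊛ G) i j                       ∎

  scaleʳ-⊛₂ : ∀ r F G i j → (F B.⊛ (λ i j → r * G i j)) i j ≈ r * (F B.⊛ G) i j
  scaleʳ-⊛₂ r F G i j = trans (B.⊛-comm F (λ i j → r * G i j) i j)
    (trans (scaleˡ-⊛₂ r G F i j) (*-congˡ (B.⊛-comm G F i j)))

  -- The bivariate series f(sa + tb), where a belongs to the outer index and b to the inner one.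
  sub : Carrier → Carrier → Series → B.Series
  sub s t f zero    = scale t f
  sub s t f (suc i) = λ j → s * sub s t (∂ f) i j

  sub-coeff : ∀ s t f i j → sub s t f i j ≈ pow s i * (pow t j * f (i ℕ.+ j))
  sub-coeff s t f zero    j = sym (*-identityˡ _)
  sub-coeff s t f (suc i) j = trans (*-congˡ (sub-coeff s t (∂ f) i j)) (sym (*-assoc _ _ _))

  sub-cong : ∀ {s s′ t t′ f f′} → s ≈ s′ → t ≈ t′ → f ≋ f′ → sub s t f B.≋ sub s′ t′ f′
  sub-cong {s} {s′} {t} {t′} {f} {f′} p q r i j = trans (sub-coeff s t f i j)
    (trans (*-cong (pow-cong p i) (*-cong (pow-cong q j) (r (i ℕ.+ j)))) (sym (sub-coeff s′ t′ f′ i j)))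

  sub-congᶠ : ∀ s t {f f′} → f ≋ f′ → sub s t f B.≋ sub s t f′
  sub-congᶠ s t = sub-cong {s} {s} {t} {t} refl refl

  sub-⊞ : ∀ s t f g → sub s t (f ⊞ g) B.≋ sub s t f S.+ sub s t g
  sub-⊞ s t f g zero    j = scale-⊞ t f g j
  sub-⊞ s t f g (suc i) j = trans (*-congˡ (sub-⊞ s t (∂ f) (∂ g) i j)) (distribˡ _ _ _)

  sub-⊟ : ∀ s t f → sub s t (⊟ f) B.≋ S.- sub s t f
  sub-⊟ s t f zero    j = sym (-‿distribʳ-* _ _)
  sub-⊟ s t f (suc i) j = trans (*-congˡ (sub-⊟ s t (∂ f) i j)) (sym (-‿distribʳ-* _ _))

  -- The chain rule in the outer variable holds by the definition of `sub`, so induction on the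
  -- outer index reduces multiplicativity to `scale-⊛` in the inner variable.
  sub-⊛ : ∀ s t f g → sub s t (f ⊛ g) B.≋ sub s t f B.⊛ sub s t g
  sub-⊛ s t f g zero    j = scale-⊛ t f g j
  sub-⊛ s t f g (suc i) j = begin
    s * sub s t (∂ f ⊛ g ⊞ f ⊛ ∂ g) i j
      ≈⟨ *-congˡ (sub-⊞ s t (∂ f ⊛ g) (f ⊛ ∂ g) i j) ⟩
    s * (sub s t (∂ f ⊛ g) i j + sub s t (f ⊛ ∂ g) i j)
      ≈⟨ *-congˡ (+-cong (sub-⊛ s t (∂ f) g i j) (sub-⊛ s t f (∂ g) i j)) ⟩
    s * ((sub s t (∂ f) B.⊛ sub s t g) i j + (sub s t f B.⊛ sub s t (∂ g)) i j)
      ≈⟨ distribˡ _ _ _ ⟩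
    s * (sub s t (∂ f) B.⊛ sub s t g) i j + s * (sub s t f B.⊛ sub s t (∂ g)) i j
      ≈⟨ +-cong (scaleˡ-⊛₂ s (sub s t (∂ f)) (sub s t g) i j) (scaleʳ-⊛₂ s (sub s t f) (sub s t (∂ g)) i j) ⟨
    (B.∂ (sub s t f) B.⊛ sub s t g) i j + (sub s t f B.⊛ B.∂ (sub s t g)) i j ∎

  sub-const : ∀ s t r → sub s t (const r) B.≋ B.const (const r)
  sub-const s t r zero    j = scale-const t r j
  sub-const s t r (suc i) j = trans (sub-coeff s t (const r) (suc i) j)
    (trans (*-congˡ (zeroʳ _)) (zeroʳ _))

  sub-scale : ∀ r s t f → sub (r * s) (r * t) f B.≋ sub s t (scale r f)
  sub-scale r s t f i j = begin
    sub (r * s) (r * t) f i j                              ≈⟨ sub-coeff (r * s) (r * t) f i j ⟩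
    pow (r * s) i * (pow (r * t) j * f (i ℕ.+ j))          ≈⟨ *-cong (pow-* r s i) (*-congʳ (pow-* r t j)) ⟩
    (pow r i * pow s i) * ((pow r j * pow t j) * f (i ℕ.+ j))
      ≈⟨ solve 5 (λ a b c d e → (a :* b) :* ((c :* d) :* e) := b :* (d :* ((a :* c) :* e))) refl (pow r i) (pow s i) (pow r j) (pow t j) (f (i ℕ.+ j)) ⟩
    pow s i * (pow t j * ((pow r i * pow r j) * f (i ℕ.+ j))) ≈⟨ *-congˡ (*-congˡ (*-congʳ (pow-+ r i j))) ⟨
    pow s i * (pow t j * scale r f (i ℕ.+ j))              ≈⟨ sub-coeff s t (scale r f) i j ⟨
    sub s t (scale r f) i j                                ∎

  -- `γ l` lives in degree l only, so any weight depending on the degree may be frozen at its value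
  -- there; the weights needed are signs and the index itself.
  γ-* : ∀ (φ : ℕ → Carrier) l n → φ n * γ l n ≈ φ l * γ l n
  γ-* φ zero    zero    = refl
  γ-* φ zero    (suc n) = trans (zeroʳ _) (sym (zeroʳ _))
  γ-* φ (suc l) zero    = trans (zeroʳ _) (sym (zeroʳ _))
  γ-* φ (suc l) (suc n) = γ-* (λ k → φ (suc k)) l n

  sub-*ˡ : ∀ s t r f i j → sub s t (λ n → r * f n) i j ≈ r * sub s t f i j
  sub-*ˡ s t r f zero    j = *-leftSwap _ _ _
  sub-*ˡ s t r f (suc i) j = trans (*-congˡ (sub-*ˡ s t r (∂ f) i j)) (*-leftSwap _ _ _)

  sub-neg-γ : ∀ s t l i j → sub (- s) (- t) (γ l) i j ≈ pow (- 1#) l * sub s t (γ l) i j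
  sub-neg-γ s t l i j = begin
    sub (- s) (- t) (γ l) i j               ≈⟨ sub-cong {f = γ l} (-1*x≈-x s) (-1*x≈-x t) (λ _ → refl) i j ⟨
    sub (- 1# * s) (- 1# * t) (γ l) i j     ≈⟨ sub-scale (- 1#) s t (γ l) i j ⟩
    sub s t (scale (- 1#) (γ l)) i j        ≈⟨ sub-congᶠ s t (γ-* (pow (- 1#)) l) i j ⟩
    sub s t (λ n → pow (- 1#) l * γ l n) i j ≈⟨ sub-*ˡ s t (pow (- 1#) l) (γ l) i j ⟩
    pow (- 1#) l * sub s t (γ l) i j        ∎

  -- The exponential of pa + qb. All exponents in the proof are linear in a and b, so identities
  -- between products of exponentials become two identities between coefficients in R.
  exp₂ : Carrier → Carrier → B.Series
  exp₂ p q i j = pow p i * pow q j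

  exp₂-cong : ∀ {p p′ q q′} → p ≈ p′ → q ≈ q′ → exp₂ p q B.≋ exp₂ p′ q′
  exp₂-cong e e′ i j = *-cong (pow-cong e i) (pow-cong e′ j)

  exp₂-⊛ : ∀ p q p′ q′ → exp₂ p q B.⊛ exp₂ p′ q′ B.≋ exp₂ (p + p′) (q + q′)
  exp₂-⊛ p q p′ q′ zero    j = trans (⊛-cong (λ k → *-identityˡ _) (λ k → *-identityˡ _) j)
    (trans (exp-⊛ q q′ j) (sym (*-identityˡ _)))
  exp₂-⊛ p q p′ q′ (suc i) j = begin
    (B.∂ (exp₂ p q) B.⊛ exp₂ p′ q′) i j + (exp₂ p q B.⊛ B.∂ (exp₂ p′ q′)) i j
      ≈⟨ +-cong (B.⊛-congʳ {g = exp₂ p′ q′} (λ _ _ → *-assoc _ _ _) i j) (B.⊛-congˡ {f = exp₂ p q} (λ _ _ → *-assoc _ _ _) i j) ⟩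
    ((λ i j → p * exp₂ p q i j) B.⊛ exp₂ p′ q′) i j + (exp₂ p q B.⊛ (λ i j → p′ * exp₂ p′ q′ i j)) i j
      ≈⟨ +-cong (scaleˡ-⊛₂ p (exp₂ p q) (exp₂ p′ q′) i j) (scaleʳ-⊛₂ p′ (exp₂ p q) (exp₂ p′ q′) i j) ⟩
    p * (exp₂ p q B.⊛ exp₂ p′ q′) i j + p′ * (exp₂ p q B.⊛ exp₂ p′ q′) i j
      ≈⟨ distribʳ _ _ _ ⟨
    (p + p′) * (exp₂ p q B.⊛ exp₂ p′ q′) i j
      ≈⟨ *-congˡ (exp₂-⊛ p q p′ q′ i j) ⟩
    (p + p′) * exp₂ (p + p′) (q + q′) i j
      ≈⟨ *-assoc _ _ _ ⟨
    exp₂ (p + p′) (q + q′) (suc i) j ∎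

  exp₂-0# : ∀ {p q} → p ≈ 0# → q ≈ 0# → exp₂ p q B.≋ S.1#
  exp₂-0# {p} {q} e e′ zero    j = trans (*-identityˡ _) (trans (pow-cong e′ j) (exp-0# j))
  exp₂-0# {p} {q} e e′ (suc i) j = trans (*-congʳ (trans (*-congʳ e) (zeroˡ _))) (zeroˡ _)

  sub-exp : ∀ s t x → sub s t (exp x) B.≋ exp₂ (s * x) (t * x)
  sub-exp s t x i j = begin
    sub s t (exp x) i j                      ≈⟨ sub-coeff s t (exp x) i j ⟩
    pow s i * (pow t j * pow x (i ℕ.+ j))    ≈⟨ *-congˡ (*-congˡ (pow-+ x i j)) ⟩
    pow s i * (pow t j * (pow x i * pow x j)) ≈⟨ solve 4 (λ a b c d → a :* (b :* (c :* d)) := (a :* c) :* (b :* d)) refl (pow s i) (pow t j) (pow x i) (pow x j) ⟩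
    (pow s i * pow x i) * (pow t j * pow x j) ≈⟨ *-cong (pow-* s x i) (pow-* t x j) ⟨
    exp₂ (s * x) (t * x) i j                 ∎

  linear : Carrier → Carrier → B.Series
  linear s t = sub s t (γ 1)

  -- `B.γ 1` is the variable a and `B.const (γ 1)` is the variable b.
  linear-coeff : ∀ s t i j → linear s t i j ≈ s * B.γ 1 i j + t * B.const (γ 1) i j
  linear-coeff s t zero    zero          = trans (zeroʳ _) (sym (trans (+-cong (zeroʳ s) (zeroʳ t)) (+-identityʳ _)))
  linear-coeff s t zero    (suc zero)    = trans (trans (*-identityʳ _)  (*-identityʳ t))
    (sym (trans (+-cong (zeroʳ s) (*-identityʳ t)) (+-identityˡ t)))
  linear-coeff s t zero    (suc (suc j)) = trans (zeroʳ _) (sym (trans (+-cong (zeroʳ s) (zeroʳ t)) (+-identityʳ _)))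
  linear-coeff s t (suc zero) j          = trans (*-congˡ (scale-const t 1# j)) (sym (trans (+-congˡ (zeroʳ t)) (+-identityʳ _)))
  linear-coeff s t (suc (suc i)) j       = trans
    (*-congˡ (sub-const s t 1# (suc i) j)) (sym (trans (+-congˡ (zeroʳ t)) (+-identityʳ _)))

  -- Multiplication by a variable lowers an index and weights by it; this produces the factors m and
  -- n of the last two identities. At index 0 the truncated predecessor meets the weight `nat 0`.
  linear-⊛ : ∀ s t F i j → (linear s t B.⊛ F) i j ≈ s * (nat i * F (i ∸ 1) j) + t * (nat j * F i (j ∸ 1))
  linear-⊛ s t F i j = begin
    (linear s t B.⊛ F) i j
      ≈⟨ B.⊛-congʳ {g = F} (linear-coeff s t) i j ⟩
    ((λ i j → s * B.γ 1 i j + t * B.const (γ 1) i j) B.⊛ F) i j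
      ≈⟨ B.⊛-distribʳ F (λ i j → s * B.γ 1 i j) (λ i j → t * B.const (γ 1) i j) i j ⟩
    ((λ i j → s * B.γ 1 i j) B.⊛ F) i j + ((λ i j → t * B.const (γ 1) i j) B.⊛ F) i j
      ≈⟨ +-cong (scaleˡ-⊛₂ s (B.γ 1) F i j) (scaleˡ-⊛₂ t (B.const (γ 1)) F i j) ⟩
    s * (B.γ 1 B.⊛ F) i j + t * (B.const (γ 1) B.⊛ F) i j
      ≈⟨ +-cong (*-congˡ (BS.γ-⊛ 1 F i j)) (*-congˡ (B.const-⊛ (γ 1) F i j)) ⟩
    s * (BS.bin i 1 ⊛ F (i ∸ 1)) j + t * (γ 1 ⊛ F i) j
      ≈⟨ +-cong (*-congˡ (trans (const-⊛ (bin i 1) (F (i ∸ 1)) j) (*-congʳ (ι-cong (≡.cong ℕ→ℚ (nC1≡n i))))))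
           (*-congˡ (trans (γ-⊛ 1 (F i) j) (*-congʳ (ι-cong (≡.cong ℕ→ℚ (nC1≡n j)))))) ⟩
    s * (nat i * F (i ∸ 1) j) + t * (nat j * F i (j ∸ 1)) ∎

  -- The coefficient of `a^(i+1) b^j` in a vanishing product expresses (i + 1) F_{i,j} through
  -- F_{i+1,j-1}. Hence the induction runs over j with i general, and each step divides by a
  -- positive integer. The cases used are a - b and a.
  regular-linear-1# : ∀ t → SA.Regular (linear 1# t)
  regular-linear-1# t F e = λ i j → vanish j i
    where
    equation : ∀ i j → nat (suc i) * F i j + t * (nat j * F (suc i) (j ∸ 1)) ≈ 0#
    equation i j = trans (+-congʳ (sym (*-identityˡ _))) (trans (sym (linear-⊛ 1# t F (suc i) j)) (e (suc i) j))
    vanish : ∀ j i → F i j ≈ 0#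
    vanish zero    i = regular-nat-suc i (F i 0) (trans (sym (trans (+-congˡ
      (trans (*-congˡ (trans (*-congʳ ι-0) (zeroˡ _))) (zeroʳ t))) (+-identityʳ _))) (equation i 0))
    vanish (suc j) i = regular-nat-suc i (F i (suc j)) (trans (sym (trans (+-congˡ
      (trans (*-congˡ (trans (*-congˡ (vanish j (suc i))) (zeroʳ _))) (zeroʳ t))) (+-identityʳ _))) (equation i (suc j)))

  regular-linear-0#-1# : SA.Regular (linear 0# 1#)
  regular-linear-0#-1# F e i j = regular-nat-suc j (F i j)
    (trans (sym (trans (+-cong (zeroˡ _) (*-identityˡ _)) (+-identityˡ _)))
      (trans (sym (linear-⊛ 0# 1# F i (suc j))) (e i (suc j))))

-- Regular denominators and the two equations for linear forms.

module Base {c ℓ : Level} (R : CommutativeRing c ℓ) (ι : ℚ → CommutativeRing.Carrier R)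
  (ι-hom : RationalHomomorphism R ι) where
  open CommutativeRing R
  open SetoidReasoning setoid
  open Bivariate R ι ι-hom public
  open RingProperties ring using (-1*x≈-x)

  two₂ : B.Series
  two₂ = S.1# S.+ S.1#

  regular-two₂ : SA.Regular two₂
  regular-two₂ = SA.regular-factor (B.const (const ½)) two₂ half*two
    (λ F e → S.trans (S.sym (S.*-identityˡ F)) e)
    where
    half*two : B.const (const ½) B.⊛ two₂ S.≈ S.1#
    half*two = S.begin
      B.const (const ½) B.⊛ two₂ S.≈⟨ S.distribˡ (B.const (const ½)) S.1# S.1# ⟩
      B.const (const ½) B.⊛ S.1# S.+ B.const (const ½) B.⊛ S.1#
        S.≈⟨ S.+-cong (S.*-identityʳ (B.const (const ½))) (S.*-identityʳ (B.const (const ½))) ⟩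
      B.const (const ½) S.+ B.const (const ½)
        S.≈⟨ (λ { zero zero → ½+½ ; zero (suc j) → +-identityˡ 0# ; (suc i) j → +-identityˡ 0# }) ⟩
      S.1# S.∎

  sub-1# : ∀ s t → sub s t (const 1#) B.≋ S.1#
  sub-1# s t = sub-const s t 1#

  sub-exp-1# : ∀ s t → sub s t (exp 1#) B.≋ exp₂ s t
  sub-exp-1# s t i j = trans (sub-exp s t 1# i j) (exp₂-cong (*-identityʳ s) (*-identityʳ t) i j)

  sub-BPs : ∀ s t x → sub s t (BPs x) B.⊛ (exp₂ s t S.- S.1#) S.≈ linear s t B.⊛ exp₂ (s * x) (t * x)
  sub-BPs s t x = S.begin
    sub s t (BPs x) B.⊛ (exp₂ s t S.- S.1#)
      S.≈⟨ S.*-congˡ {sub s t (BPs x)} (S.+-cong (sub-exp-1# s t) (S.-‿cong (sub-1# s t))) ⟨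
    sub s t (BPs x) B.⊛ (sub s t (exp 1#) S.- sub s t (const 1#))
      S.≈⟨ S.*-congˡ {sub s t (BPs x)} (S.trans (sub-⊞ s t (exp 1#) (⊟ const 1#)) (S.+-congˡ {sub s t (exp 1#)} (sub-⊟ s t (const 1#)))) ⟨
    sub s t (BPs x) B.⊛ sub s t (exp 1# ⊞ (⊟ const 1#))
      S.≈⟨ sub-⊛ s t (BPs x) (exp 1# ⊞ (⊟ const 1#)) ⟨
    sub s t (BPs x ⊛ (exp 1# ⊞ (⊟ const 1#)))
      S.≈⟨ sub-congᶠ s t (BPs-exp x) ⟩
    sub s t (γ 1 ⊛ exp x)
      S.≈⟨ sub-⊛ s t (γ 1) (exp x) ⟩
    linear s t B.⊛ sub s t (exp x)
      S.≈⟨ S.*-congˡ {linear s t} (sub-exp s t x) ⟩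
    linear s t B.⊛ exp₂ (s * x) (t * x) S.∎

  sub-EPs : ∀ s t x → sub s t (EPs x) B.⊛ (exp₂ s t S.+ S.1#) S.≈ two₂ B.⊛ exp₂ (s * x) (t * x)
  sub-EPs s t x = S.begin
    sub s t (EPs x) B.⊛ (exp₂ s t S.+ S.1#)
      S.≈⟨ S.*-congˡ {sub s t (EPs x)} (S.+-cong (sub-exp-1# s t) (sub-1# s t)) ⟨
    sub s t (EPs x) B.⊛ (sub s t (exp 1#) S.+ sub s t (const 1#))
      S.≈⟨ S.*-congˡ {sub s t (EPs x)} (sub-⊞ s t (exp 1#) (const 1#)) ⟨
    sub s t (EPs x) B.⊛ sub s t (exp 1# ⊞ const 1#)
      S.≈⟨ sub-⊛ s t (EPs x) (exp 1# ⊞ const 1#) ⟨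
    sub s t (EPs x ⊛ (exp 1# ⊞ const 1#))
      S.≈⟨ sub-congᶠ s t (EPs-exp x) ⟩
    sub s t (two ⊛ exp x)
      S.≈⟨ sub-⊛ s t two (exp x) ⟩
    sub s t two B.⊛ sub s t (exp x)
      S.≈⟨ S.*-cong (S.trans (sub-⊞ s t (const 1#) (const 1#)) (S.+-cong (sub-1# s t) (sub-1# s t))) (sub-exp s t x) ⟩
    two₂ B.⊛ exp₂ (s * x) (t * x) S.∎

  -- At x = 0 the exponential on the right of `sub-BPs` is 1, so the denominator divides the linear
  -- form, the Bernoulli series being the cofactor. In the same way the Euler series exhibits
  -- `exp₂ s t + 1` as a divisor of 2.
  regular-exp₂-1# : ∀ s t → SA.Regular (linear s t) → SA.Regular (exp₂ s t S.- S.1#)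
  regular-exp₂-1# s t = SA.regular-factor (sub s t (BPs 0#)) (exp₂ s t S.- S.1#)
    (S.trans (sub-BPs s t 0#) (S.trans (S.*-congˡ {linear s t} (exp₂-0# (zeroʳ s) (zeroʳ t))) (S.*-identityʳ (linear s t))))

  regular-exp₂+1# : ∀ s t → SA.Regular (exp₂ s t S.+ S.1#)
  regular-exp₂+1# s t = SA.regular-factor (sub s t (EPs 0#)) (exp₂ s t S.+ S.1#)
    (S.trans (sub-EPs s t 0#) (S.trans (S.*-congˡ {two₂} (exp₂-0# (zeroʳ s) (zeroʳ t))) (S.*-identityʳ two₂))) regular-two₂

  exp₂-inverse : ∀ s t → exp₂ (- s) (- t) B.⊛ exp₂ s t S.≈ S.1#
  exp₂-inverse s t = S.trans (exp₂-⊛ (- s) (- t) s t) (exp₂-0# (-‿inverseˡ s) (-‿inverseˡ t))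

  exp₂-reflect : ∀ s t x → exp₂ (- s * x) (- t * x) B.⊛ exp₂ s t S.≈ exp₂ (s * (1# - x)) (t * (1# - x))
  exp₂-reflect s t x = S.trans (exp₂-⊛ (- s * x) (- t * x) s t) (exp₂-cong (reflect s) (reflect t))
    where
    reflect : ∀ r → - r * x + r ≈ r * (1# - x)
    reflect r = begin
      - r * x + r        ≈⟨ +-congˡ (*-identityʳ r) ⟨
      - r * x + r * 1#   ≈⟨ solve 3 (λ r x u → :- r :* x :+ r :* u := r :* (u :- x)) refl r x 1# ⟩
      r * (1# - x)       ∎

  linear-neg : ∀ s t → linear (- s) (- t) S.≈ S.- linear s t
  linear-neg s t i j = trans (sub-neg-γ s t 1 i j) (trans (*-congʳ (*-identityʳ _)) (-1*x≈-x _))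

  -- This is the reflection formula for Bernoulli polynomials. It gives the series at the negated
  -- linear form the denominator of the original one, so that only the denominators belonging to a,
  -- b and c have to be cancelled.
  sub-BPs-reflect : ∀ s t x → sub (- s) (- t) (BPs x) B.⊛ (exp₂ s t S.- S.1#)
                                S.≈ linear s t B.⊛ exp₂ (s * (1# - x)) (t * (1# - x))
  sub-BPs-reflect s t x = S.begin
    b B.⊛ (e S.- S.1#)
      S.≈⟨ S.*-congˡ {b} (S.+-congˡ {e} (S.-‿cong (exp₂-inverse s t))) ⟨
    b B.⊛ (e S.- e′ B.⊛ e)
      -- The unit is passed to the solver as a variable u, so the factor u must be written out
      -- before the identity holds for every u.
      S.≈⟨ S.*-congˡ {b} (S.+-congʳ (S.*-identityˡ e)) ⟨
    b B.⊛ (S.1# B.⊛ e S.- e′ B.⊛ e)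
      S.≈⟨ SA.solve 4 (λ b e e′ u → b SA.:* (u SA.:* e SA.:- e′ SA.:* e) SA.:= (b SA.:* (e′ SA.:- u)) SA.:* (SA.:- e)) S.refl b e e′ S.1# ⟩
    (b B.⊛ (e′ S.- S.1#)) B.⊛ (S.- e)
      S.≈⟨ S.*-congʳ {S.- e} (S.trans (sub-BPs (- s) (- t) x) (S.*-congʳ {p} (linear-neg s t))) ⟩
    ((S.- linear s t) B.⊛ p) B.⊛ (S.- e)
      S.≈⟨ SA.solve 3 (λ l p e → (SA.:- l SA.:* p) SA.:* (SA.:- e) SA.:= l SA.:* (p SA.:* e)) S.refl (linear s t) p e ⟩
    linear s t B.⊛ (p B.⊛ e)
      S.≈⟨ S.*-congˡ {linear s t} (exp₂-reflect s t x) ⟩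
    linear s t B.⊛ exp₂ (s * (1# - x)) (t * (1# - x)) S.∎
    where
    b e e′ p : B.Series
    b  = sub (- s) (- t) (BPs x)
    e  = exp₂ s t
    e′ = exp₂ (- s) (- t)
    p  = exp₂ (- s * x) (- t * x)

  sub-EPs-reflect : ∀ s t x → sub (- s) (- t) (EPs x) B.⊛ (exp₂ s t S.+ S.1#)
                                S.≈ two₂ B.⊛ exp₂ (s * (1# - x)) (t * (1# - x))
  sub-EPs-reflect s t x = S.begin
    b B.⊛ (e S.+ S.1#)
      S.≈⟨ S.*-congˡ {b} (S.+-congˡ {e} (exp₂-inverse s t)) ⟨
    b B.⊛ (e S.+ e′ B.⊛ e)
      S.≈⟨ S.*-congˡ {b} (S.+-congʳ (S.*-identityˡ e)) ⟨
    b B.⊛ (S.1# B.⊛ e S.+ e′ B.⊛ e)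
      S.≈⟨ SA.solve 4 (λ b e e′ u → b SA.:* (u SA.:* e SA.:+ e′ SA.:* e) SA.:= (b SA.:* (e′ SA.:+ u)) SA.:* e) S.refl b e e′ S.1# ⟩
    (b B.⊛ (e′ S.+ S.1#)) B.⊛ e
      S.≈⟨ S.*-congʳ {e} (sub-EPs (- s) (- t) x) ⟩
    (two₂ B.⊛ p) B.⊛ e
      S.≈⟨ S.*-assoc two₂ p e ⟩
    two₂ B.⊛ (p B.⊛ e)
      S.≈⟨ S.*-congˡ {two₂} (exp₂-reflect s t x) ⟩
    two₂ B.⊛ exp₂ (s * (1# - x)) (t * (1# - x)) S.∎
    where
    b e e′ p : B.Series
    b  = sub (- s) (- t) (EPs x)
    e  = exp₂ s t
    e′ = exp₂ (- s) (- t)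
    p  = exp₂ (- s * x) (- t * x)

  module _ {x y z : Carrier} (x+y+z≈1 : x + y + z ≈ 1#) (s t s′ t′ : Carrier) where

    private
      1-y : 1# - y ≈ x + z
      1-y = trans (+-congʳ (sym x+y+z≈1)) (solve 3 (λ x y z → x :+ y :+ z :- y := x :+ z) refl x y z)

      1-z : 1# - z ≈ x + y
      1-z = trans (+-congʳ (sym x+y+z≈1)) (solve 3 (λ x y z → x :+ y :+ z :- z := x :+ y) refl x y z)

      σ τ : Carrier
      σ = s - s′
      τ = t - t′

      split : exp₂ s t S.≈ exp₂ σ τ B.⊛ exp₂ s′ t′
      split = S.sym (S.trans (exp₂-⊛ σ τ s′ t′) (exp₂-cong (e s s′) (e t t′)))
        where
        e : ∀ r r′ → r - r′ + r′ ≈ r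
        e = solve 2 (λ r r′ → r :- r′ :+ r′ := r) refl

      -- With `1 - z = x + y` the exponent cx + b(1 - z) is ax + by, because c + b = a.
      PU : exp₂ (σ * x) (τ * x) B.⊛ exp₂ (s′ * (1# - z)) (t′ * (1# - z))
             S.≈ exp₂ (s * x) (t * x) B.⊛ exp₂ (s′ * y) (t′ * y)
      PU = S.trans (exp₂-⊛ (σ * x) (τ * x) (s′ * (1# - z)) (t′ * (1# - z)))
        (S.trans (exp₂-cong (e s s′) (e t t′)) (S.sym (exp₂-⊛ (s * x) (t * x) (s′ * y) (t′ * y))))
        where
        e : ∀ r r′ → (r - r′) * x + r′ * (1# - z) ≈ r * x + r′ * y
        e r r′ = trans (+-congˡ (*-congˡ 1-z))
          (solve 4 (λ r r′ x y → (r :- r′) :* x :+ r′ :* (x :+ y) := r :* x :+ r′ :* y) refl r r′ x y)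

      QV : exp₂ (σ * (1# - y)) (τ * (1# - y)) B.⊛ exp₂ (s * (1# - z)) (t * (1# - z))
             S.≈ exp₂ σ τ B.⊛ (exp₂ (s * x) (t * x) B.⊛ exp₂ (s′ * y) (t′ * y))
      QV = S.trans (exp₂-⊛ (σ * (1# - y)) (τ * (1# - y)) (s * (1# - z)) (t * (1# - z)))
        (S.trans (exp₂-cong (e s s′) (e t t′)) (S.sym
          (S.trans (S.*-congˡ {exp₂ σ τ} (exp₂-⊛ (s * x) (t * x) (s′ * y) (t′ * y)))
            (exp₂-⊛ σ τ (s * x + s′ * y) (t * x + t′ * y)))))
        where
        e : ∀ r r′ → (r - r′) * (1# - y) + r * (1# - z) ≈ r - r′ + (r * x + r′ * y)
        e r r′ = begin
          (r - r′) * (1# - y) + r * (1# - z)         ≈⟨ +-cong (*-congˡ 1-y) (*-congˡ 1-z) ⟩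
          (r - r′) * (x + z) + r * (x + y)
            ≈⟨ solve 5 (λ r r′ x y z → (r :- r′) :* (x :+ z) :+ r :* (x :+ y)
                 := (r :- r′) :* (x :+ y :+ z) :+ (r :* x :+ r′ :* y)) refl r r′ x y z ⟩
          -- The surplus c(x + y + z) becomes c, the exponent of the factor `exp₂ σ τ`.
          (r - r′) * (x + y + z) + (r * x + r′ * y)  ≈⟨ +-congʳ (trans (*-congˡ x+y+z≈1) (*-identityʳ _)) ⟩
          r - r′ + (r * x + r′ * y)                  ∎

    -- The overview's a, b and c are here sa + tb, s′a + t′b and their difference. This generality
    -- pays for the first two identities at once: the coefficients (1, 0, 0, 1) give the first and
    -- (-1, 1, -1, 0) the second.
    sub-bernoulli-euler : SA.Regular (linear (s - s′) (t - t′)) →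
      two₂ B.⊛ (sub (s - s′) (t - t′) (BPs x) B.⊛ sub (- s′) (- t′) (EPs z)
                S.- sub (- (s - s′)) (- (t - t′)) (BPs y) B.⊛ sub (- s) (- t) (EPs z))
      S.≈ S.- (linear (s - s′) (t - t′) B.⊛ (sub s t (EPs x) B.⊛ sub s′ t′ (EPs y)))
    sub-bernoulli-euler regular = SA.bernoulli-euler
      (regular-exp₂-1# σ τ regular) (regular-exp₂+1# s t) (regular-exp₂+1# s′ t′)
      (sub-BPs σ τ x) (sub-BPs-reflect σ τ y) (sub-EPs-reflect s′ t′ z) (sub-EPs-reflect s t z)
      (sub-EPs s t x) (sub-EPs s′ t′ y) denominators PU QV
      where
      denominators : (exp₂ s t S.+ S.1#) S.+ (exp₂ σ τ S.- S.1#) S.≈ exp₂ σ τ B.⊛ (exp₂ s′ t′ S.+ S.1#)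
      denominators = S.begin
        (exp₂ s t S.+ S.1#) S.+ (exp₂ σ τ S.- S.1#)
          S.≈⟨ SA.solve 3 (λ e f u → (e SA.:+ u) SA.:+ (f SA.:- u) SA.:= e SA.:+ f) S.refl (exp₂ s t) (exp₂ σ τ) S.1# ⟩
        exp₂ s t S.+ exp₂ σ τ
          S.≈⟨ S.+-cong split (S.sym (S.*-identityʳ (exp₂ σ τ))) ⟩
        exp₂ σ τ B.⊛ exp₂ s′ t′ S.+ exp₂ σ τ B.⊛ S.1#
          S.≈⟨ S.distribˡ (exp₂ σ τ) (exp₂ s′ t′) S.1# ⟨
        exp₂ σ τ B.⊛ (exp₂ s′ t′ S.+ S.1#) S.∎

    sub-bernoulli-bernoulli : SA.Regular (linear (s - s′) (t - t′)) → SA.Regular (linear s t) → SA.Regular (linear s′ t′) →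
      linear s t B.⊛ (sub (s - s′) (t - t′) (BPs x) B.⊛ sub (- s′) (- t′) (BPs z))
        S.- linear s′ t′ B.⊛ (sub (- (s - s′)) (- (t - t′)) (BPs y) B.⊛ sub (- s) (- t) (BPs z))
      S.≈ linear (s - s′) (t - t′) B.⊛ (sub s t (BPs x) B.⊛ sub s′ t′ (BPs y))
    sub-bernoulli-bernoulli regular regular′ regular″ = SA.bernoulli-bernoulli
      (regular-exp₂-1# σ τ regular) (regular-exp₂-1# s t regular′) (regular-exp₂-1# s′ t′ regular″)
      (sub-BPs σ τ x) (sub-BPs-reflect σ τ y) (sub-BPs-reflect s′ t′ z) (sub-BPs-reflect s t z)
      (sub-BPs s t x) (sub-BPs s′ t′ y) denominators PU QV
      where
      denominators : exp₂ s t S.- S.1# S.≈ exp₂ σ τ B.⊛ (exp₂ s′ t′ S.- S.1#) S.+ (exp₂ σ τ S.- S.1#)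
      denominators = S.begin
        exp₂ s t S.- S.1#
          S.≈⟨ S.+-congʳ split ⟩
        exp₂ σ τ B.⊛ exp₂ s′ t′ S.- S.1#
          S.≈⟨ SA.solve 3 (λ e f u → e SA.:* f SA.:- u SA.:= e SA.:* (f SA.:- u) SA.:+ (e SA.:* u SA.:- u)) S.refl (exp₂ σ τ) (exp₂ s′ t′) S.1# ⟩
        exp₂ σ τ B.⊛ (exp₂ s′ t′ S.- S.1#) S.+ (exp₂ σ τ B.⊛ S.1# S.- S.1#)
          S.≈⟨ S.+-congˡ {exp₂ σ τ B.⊛ (exp₂ s′ t′ S.- S.1#)} (S.+-congʳ (S.*-identityʳ (exp₂ σ τ))) ⟩
        exp₂ σ τ B.⊛ (exp₂ s′ t′ S.- S.1#) S.+ (exp₂ σ τ S.- S.1#) S.∎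

-- Coefficient formulas and multiplication by divided powers of c.

module Coefficients {c ℓ : Level} (R : CommutativeRing c ℓ) (ι : ℚ → CommutativeRing.Carrier R)
  (ι-hom : RationalHomomorphism R ι) where
  open CommutativeRing R
  open SetoidReasoning setoid
  open Base R ι ι-hom public
  open RingProperties ring using (-‿involutive; -0#≈0#)

  -1# : Carrier
  -1# = - 1#

  γ-> : ∀ {l n} → l < n → γ l n ≈ 0#
  γ-> {zero}  {suc n} _         = refl
  γ-> {suc l} {suc n} (s≤s l<n) = γ-> l<n

  γ-+ : ∀ {l j} i → j ≤ l → γ l (i ℕ.+ j) ≡ γ (l ∸ j) i
  γ-+ {l}     {zero}  i _         = ≡.cong (γ l) (ℕₚ.+-identityʳ i)
  γ-+ {suc l} {suc j} i (s≤s j≤l) = ≡.trans (≡.cong (γ (suc l)) (ℕₚ.+-suc i j)) (γ-+ i j≤l)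

  γ-1-⊛-γ : ∀ l → γ 1 ⊛ γ l ≋ const (nat (suc l)) ⊛ γ (suc l)
  γ-1-⊛-γ l n = trans (γ-⊛ 1 (γ l) n)
    (trans (*-congʳ (ι-cong (≡.cong ℕ→ℚ (nC1≡n n)))) (trans (shift n) (sym (const-⊛ (nat (suc l)) (γ (suc l)) n))))
    where
    shift : ∀ n → nat n * γ l (n ∸ 1) ≈ nat (suc l) * γ (suc l) n
    shift zero    = trans (trans (*-congʳ ι-0) (zeroˡ _)) (sym (zeroʳ _))
    shift (suc n) = γ-* (λ k → nat (suc k)) l n

  K : Carrier → B.Series
  K r = B.const (const r)

  K-⊛ : ∀ r F i j → (K r B.⊛ F) i j ≈ r * F i j
  K-⊛ r F i j = trans (B.const-⊛ (const r) F i j) (const-⊛ r (F i) j)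

  -- The divided power c^l/l! with c = a - b.
  γᶜ : ℕ → B.Series
  γᶜ l = sub 1# -1# (γ l)

  -- A factor with argument -c absorbs the divided power of -c; the sign recorded here is the price
  -- and reappears as the power of -1 in l in the theorem.
  γᶜ-neg : ∀ l → γᶜ l S.≈ K (pow -1# l) B.⊛ sub -1# 1# (γ l)
  γᶜ-neg l i j = begin
    sub 1# -1# (γ l) i j                  ≈⟨ sub-cong {f = γ l} (-‿involutive 1#) refl (λ _ → refl) i j ⟨
    sub (- -1#) (- 1#) (γ l) i j          ≈⟨ sub-neg-γ -1# 1# l i j ⟩
    pow -1# l * sub -1# 1# (γ l) i j      ≈⟨ K-⊛ (pow -1# l) (sub -1# 1# (γ l)) i j ⟨
    (K (pow -1# l) B.⊛ sub -1# 1# (γ l)) i j ∎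

  -- The factor l on the right of the first and third identities comes from the c in front of the
  -- right-hand product.
  linear-⊛-γᶜ : ∀ l → linear 1# -1# B.⊛ γᶜ l S.≈ K (nat (suc l)) B.⊛ γᶜ (suc l)
  linear-⊛-γᶜ l = S.begin
    linear 1# -1# B.⊛ γᶜ l                 S.≈⟨ sub-⊛ 1# -1# (γ 1) (γ l) ⟨
    sub 1# -1# (γ 1 ⊛ γ l)                S.≈⟨ sub-congᶠ 1# -1# (γ-1-⊛-γ l) ⟩
    sub 1# -1# (const (nat (suc l)) ⊛ γ (suc l)) S.≈⟨ sub-⊛ 1# -1# (const (nat (suc l))) (γ (suc l)) ⟩
    sub 1# -1# (const (nat (suc l))) B.⊛ γᶜ (suc l) S.≈⟨ S.*-congʳ {γᶜ (suc l)} (sub-const 1# -1# (nat (suc l))) ⟩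
    K (nat (suc l)) B.⊛ γᶜ (suc l)        S.∎

  ⊛-row : ∀ F t g n → (F B.⊛ sub 0# t g) n ≋ F n ⊛ scale t g
  ⊛-row F t g = B.⊛-constantʳ F (sub 0# t g) (λ i j → zeroˡ _)

  -- Since a is the outer variable, a series in b alone is a constant of the outer ring, whereas a
  -- series in a alone is handled by fixing the inner index and convolving columns.
  ⊛-column : ∀ F G → (∀ i → ∂ (G i) ≋ (λ _ → 0#)) → ∀ i j → (F B.⊛ G) i j ≈ ((λ n → F n j) ⊛ (λ n → G n 0)) i
  ⊛-column F G p zero    j = ⊛-constantʳ (F 0) (G 0) (p 0) j
  ⊛-column F G p (suc i) j = +-cong (⊛-column (B.∂ F) G p i j) (⊛-column F (B.∂ G) (λ i → p (suc i)) i j)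

  ⊛-sub-0# : ∀ F s g i j → (F B.⊛ sub s 0# g) i j ≈ ((λ n → F n j) ⊛ scale s g) i
  ⊛-sub-0# F s g i j = trans
    (⊛-column F (sub s 0# g) (λ i j → trans (sub-coeff s 0# g i (suc j))
      (trans (*-congˡ (trans (*-congʳ (zeroˡ _)) (zeroˡ _))) (zeroʳ _))) i j)
    (⊛-congˡ {λ n → F n j} (λ i → trans (sub-coeff s 0# g i 0)
      (*-congˡ (trans (*-identityˡ _) (reflexive (≡.cong g (ℕₚ.+-identityʳ i)))))) i)

  -- The second factor involves b only, so just the degree m is split. The sign of the k-th power of
  -- -b in the first factor and that of the remaining power in the second combine to one independent
  -- of k. The next lemma is the mirror image.
  coefficientᵇ : ∀ h g n m → (sub 1# -1# h B.⊛ sub 0# -1# g) n m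
    ≈ pow -1# m * sum (suc m) (λ k → bin m k * (h (n ℕ.+ k) * g (m ∸ k)))
  coefficientᵇ h g n m = begin
    (sub 1# -1# h B.⊛ sub 0# -1# g) n m                ≈⟨ ⊛-row (sub 1# -1# h) -1# g n m ⟩
    (sub 1# -1# h n ⊛ scale -1# g) m                   ≈⟨ ⊛-binomialSum (sub 1# -1# h n) (scale -1# g) m ⟩
    binomialSum m (λ i j → sub 1# -1# h n i * scale -1# g j)
      ≈⟨ sum-cong< (suc m) (λ { k (s≤s k≤m) → begin
           bin m k * (sub 1# -1# h n k * (pow -1# (m ∸ k) * g (m ∸ k)))
             ≈⟨ *-congˡ (*-congʳ (trans (sub-coeff 1# -1# h n k) (trans (*-congʳ (pow-1# n)) (*-identityˡ _)))) ⟩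
           bin m k * ((pow -1# k * h (n ℕ.+ k)) * (pow -1# (m ∸ k) * g (m ∸ k)))
             ≈⟨ solve 5 (λ a b c d e → a :* ((b :* c) :* (d :* e)) := (b :* d) :* (a :* (c :* e))) refl
                  (bin m k) (pow -1# k) (h (n ℕ.+ k)) (pow -1# (m ∸ k)) (g (m ∸ k)) ⟩
           (pow -1# k * pow -1# (m ∸ k)) * (bin m k * (h (n ℕ.+ k) * g (m ∸ k)))
             ≈⟨ *-congʳ (trans (sym (pow-+ -1# k (m ∸ k))) (reflexive (≡.cong (pow -1#) (ℕₚ.m+[n∸m]≡n k≤m)))) ⟩
           pow -1# m * (bin m k * (h (n ℕ.+ k) * g (m ∸ k))) ∎ }) ⟩
    sum (suc m) (λ k → pow -1# m * (bin m k * (h (n ℕ.+ k) * g (m ∸ k)))) ≈⟨ sum-*ˡ (pow -1# m) (suc m) _ ⟩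
    pow -1# m * sum (suc m) (λ k → bin m k * (h (n ℕ.+ k) * g (m ∸ k))) ∎

  coefficientᵃ : ∀ h g n m → (sub -1# 1# h B.⊛ sub -1# 0# g) n m
    ≈ pow -1# n * sum (suc n) (λ k → bin n k * (h (m ℕ.+ k) * g (n ∸ k)))
  coefficientᵃ h g n m = begin
    (sub -1# 1# h B.⊛ sub -1# 0# g) n m                ≈⟨ ⊛-sub-0# (sub -1# 1# h) -1# g n m ⟩
    ((λ k → sub -1# 1# h k m) ⊛ scale -1# g) n         ≈⟨ ⊛-binomialSum (λ k → sub -1# 1# h k m) (scale -1# g) n ⟩
    binomialSum n (λ i j → sub -1# 1# h i m * scale -1# g j)
      ≈⟨ sum-cong< (suc n) (λ { k (s≤s k≤n) → begin
           bin n k * (sub -1# 1# h k m * (pow -1# (n ∸ k) * g (n ∸ k)))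
             ≈⟨ *-congˡ (*-congʳ (trans (sub-coeff -1# 1# h k m) (*-congˡ (trans (*-congʳ (pow-1# m))
                  (trans (*-identityˡ _) (reflexive (≡.cong h (ℕₚ.+-comm k m)))))))) ⟩
           bin n k * ((pow -1# k * h (m ℕ.+ k)) * (pow -1# (n ∸ k) * g (n ∸ k)))
             ≈⟨ solve 5 (λ a b c d e → a :* ((b :* c) :* (d :* e)) := (b :* d) :* (a :* (c :* e))) refl
                  (bin n k) (pow -1# k) (h (m ℕ.+ k)) (pow -1# (n ∸ k)) (g (n ∸ k)) ⟩
           (pow -1# k * pow -1# (n ∸ k)) * (bin n k * (h (m ℕ.+ k) * g (n ∸ k)))
             ≈⟨ *-congʳ (trans (sym (pow-+ -1# k (n ∸ k))) (reflexive (≡.cong (pow -1#) (ℕₚ.m+[n∸m]≡n k≤n)))) ⟩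
           pow -1# n * (bin n k * (h (m ℕ.+ k) * g (n ∸ k))) ∎ }) ⟩
    sum (suc n) (λ k → pow -1# n * (bin n k * (h (m ℕ.+ k) * g (n ∸ k)))) ≈⟨ sum-*ˡ (pow -1# n) (suc n) _ ⟩
    pow -1# n * sum (suc n) (λ k → bin n k * (h (m ℕ.+ k) * g (n ∸ k))) ∎

  -- In the divided power of c, `b^k` is paired with `a^(l-k)`. So the sum stops at l, which does
  -- not exceed m, and f is left with the degree n - (l - k), equal to `n ∸ l + k` because l ≤ n.
  coefficientᶜ : ∀ f g {l n m} → l ≤ n → l ≤ m → (γᶜ l B.⊛ (sub 1# 0# f B.⊛ sub 0# 1# g)) n m
    ≈ sum (suc l) (λ k → pow -1# k * bin m k * bin n (l ∸ k) * f (n ∸ l ℕ.+ k) * g (m ∸ k))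
  coefficientᶜ f g {l} {n} {m} l≤n l≤m = begin
    (γᶜ l B.⊛ (sub 1# 0# f B.⊛ sub 0# 1# g)) n m
      ≈⟨ B.⊛-assoc (γᶜ l) (sub 1# 0# f) (sub 0# 1# g) n m ⟨
    ((γᶜ l B.⊛ sub 1# 0# f) B.⊛ sub 0# 1# g) n m
      ≈⟨ ⊛-row (γᶜ l B.⊛ sub 1# 0# f) 1# g n m ⟩
    ((γᶜ l B.⊛ sub 1# 0# f) n ⊛ scale 1# g) m
      ≈⟨ ⊛-cong {g = scale 1# g} (λ j → trans (⊛-sub-0# (γᶜ l) 1# f n j) (⊛-congˡ {λ i → γᶜ l i j} (scale-1# f) n)) (scale-1# g) m ⟩
    (F ⊛ g) m
      ≈⟨ ⊛-binomialSum F g m ⟩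
    sum (suc m) (λ k → bin m k * (F k * g (m ∸ k)))
      ≡⟨ ≡.cong (λ i → sum i (λ k → bin m k * (F k * g (m ∸ k)))) (≡.sym (≡.cong suc (ℕₚ.m+[n∸m]≡n l≤m))) ⟩
    sum (suc l ℕ.+ (m ∸ l)) (λ k → bin m k * (F k * g (m ∸ k)))
      ≈⟨ sum-truncate (suc l) (m ∸ l) _ (λ k l<k → trans (*-congˡ (trans (*-congʳ (F-> l<k)) (zeroˡ _))) (zeroʳ _)) ⟩
    sum (suc l) (λ k → bin m k * (F k * g (m ∸ k)))
      ≈⟨ sum-cong< (suc l) (λ { k (s≤s k≤l) → trans (*-congˡ (*-congʳ (F-≤ k≤l)))
           (solve 5 (λ a b c d e → a :* ((b :* (c :* d)) :* e) := b :* a :* c :* d :* e) refl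
             (bin m k) (pow -1# k) (bin n (l ∸ k)) (f (n ∸ l ℕ.+ k)) (g (m ∸ k))) }) ⟩
    sum (suc l) (λ k → pow -1# k * bin m k * bin n (l ∸ k) * f (n ∸ l ℕ.+ k) * g (m ∸ k)) ∎
    where
    scale-1# : ∀ f → scale 1# f ≋ f
    scale-1# f i = trans (*-congʳ (pow-1# i)) (*-identityˡ _)
    F : Series
    F j = ((λ i → γᶜ l i j) ⊛ f) n
    γᶜ-coeff : ∀ i j → γᶜ l i j ≈ pow -1# j * γ l (i ℕ.+ j)
    γᶜ-coeff i j = trans (sub-coeff 1# -1# (γ l) i j) (trans (*-congʳ (pow-1# i)) (*-identityˡ _))
    F-> : ∀ {k} → l < k → F k ≈ 0#
    F-> {k} l<k = trans (⊛-comm (λ i → γᶜ l i k) f n) (⊛-zeroʳ f (λ i → trans (γᶜ-coeff i k)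
      (trans (*-congˡ (γ-> (ℕₚ.<-≤-trans l<k (ℕₚ.m≤n+m k i)))) (zeroʳ _))) n)
    F-≤ : ∀ {k} → k ≤ l → F k ≈ pow -1# k * (bin n (l ∸ k) * f (n ∸ l ℕ.+ k))
    F-≤ {k} k≤l = begin
      ((λ i → γᶜ l i k) ⊛ f) n
        ≈⟨ ⊛-congʳ (λ i → trans (γᶜ-coeff i k) (*-congˡ (reflexive (γ-+ i k≤l)))) n ⟩
      ((λ i → pow -1# k * γ (l ∸ k) i) ⊛ f) n
        ≈⟨ scaleˡ-⊛ (pow -1# k) (γ (l ∸ k)) f n ⟩
      pow -1# k * (γ (l ∸ k) ⊛ f) n
        ≈⟨ *-congˡ (γ-⊛ (l ∸ k) f n) ⟩
      pow -1# k * (bin n (l ∸ k) * f (n ∸ (l ∸ k)))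
        ≡⟨ ≡.cong (λ i → pow -1# k * (bin n (l ∸ k) * f i)) n∸[l∸k] ⟩
      pow -1# k * (bin n (l ∸ k) * f (n ∸ l ℕ.+ k)) ∎
      where
      n∸[l∸k] : n ∸ (l ∸ k) ≡ n ∸ l ℕ.+ k
      n∸[l∸k] = ≡.trans (≡.cong (_∸ (l ∸ k)) (≡.trans (≡.sym (ℕₚ.m∸n+n≡m l≤n))
        (≡.cong (n ∸ l ℕ.+_) (≡.sym (ℕₚ.m+[n∸m]≡n k≤l)))))
        (≡.trans (≡.cong (_∸ (l ∸ k)) (≡.sym (ℕₚ.+-assoc (n ∸ l) k (l ∸ k)))) (ℕₚ.m+n∸n≡m (n ∸ l ℕ.+ k) (l ∸ k)))

  two₂-⊛ : ∀ F → two₂ B.⊛ F S.≈ F S.+ F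
  two₂-⊛ F = S.trans (S.distribʳ F S.1# S.1#) (S.+-cong (S.*-identityˡ F) (S.*-identityˡ F))

  private
    1-0 : 1# - 0# ≈ 1#
    1-0 = trans (+-congˡ -0#≈0#) (+-identityʳ 1#)
    0-1 : 0# - 1# ≈ -1#
    0-1 = +-identityˡ -1#
    sub-≈ : ∀ {s s′ t t′} f → s ≈ s′ → t ≈ t′ → sub s t f S.≈ sub s′ t′ f
    sub-≈ f p q = sub-cong {f = f} p q (λ _ → refl)

    γᶜ-⊛ : ∀ l f g → sub 1# -1# (γ l ⊛ f) B.⊛ g S.≈ γᶜ l B.⊛ (sub 1# -1# f B.⊛ g)
    γᶜ-⊛ l f g = S.trans (S.*-congʳ {g} (sub-⊛ 1# -1# (γ l) f)) (S.*-assoc (γᶜ l) (sub 1# -1# f) g)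

    γᶜ-⊛-neg : ∀ l f g → K (pow -1# l) B.⊛ (sub -1# 1# (γ l ⊛ f) B.⊛ g) S.≈ γᶜ l B.⊛ (sub -1# 1# f B.⊛ g)
    γᶜ-⊛-neg l f g = S.begin
      k B.⊛ (sub -1# 1# (γ l ⊛ f) B.⊛ g)   S.≈⟨ S.*-congˡ {k} (S.*-congʳ {g} (sub-⊛ -1# 1# (γ l) f)) ⟩
      k B.⊛ ((γ′ B.⊛ f′) B.⊛ g)            S.≈⟨ SA.solve 4 (λ k γ f g → k SA.:* ((γ SA.:* f) SA.:* g) SA.:= (k SA.:* γ) SA.:* (f SA.:* g)) S.refl k γ′ f′ g ⟩
      (k B.⊛ γ′) B.⊛ (f′ B.⊛ g)            S.≈⟨ S.*-congʳ {f′ B.⊛ g} (γᶜ-neg l) ⟨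
      γᶜ l B.⊛ (f′ B.⊛ g)                  S.∎
      where
      k γ′ f′ : B.Series
      k = K (pow -1# l)
      γ′ = sub -1# 1# (γ l)
      f′ = sub -1# 1# f

  module _ {x y z : Carrier} (x+y+z≈1 : x + y + z ≈ 1#) where

    -- On the left the divided power enters the Bernoulli series in c and -c, the form that
    -- `coefficientᵇ` and `coefficientᵃ` read off; on the right it merges with c. The index l is one
    -- less than in the theorem.
    identity₁ : ∀ l →
      two₂ B.⊛ (sub 1# -1# (γ l ⊛ BPs x) B.⊛ sub 0# -1# (EPs z)
                S.- K (pow -1# l) B.⊛ (sub -1# 1# (γ l ⊛ BPs y) B.⊛ sub -1# 0# (EPs z)))
      S.≈ S.- (K (nat (suc l)) B.⊛ (γᶜ (suc l) B.⊛ (sub 1# 0# (EPs x) B.⊛ sub 0# 1# (EPs y))))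
    identity₁ l = S.begin
      two₂ B.⊛ (sub 1# -1# (γ l ⊛ BPs x) B.⊛ e₁ S.- K (pow -1# l) B.⊛ (sub -1# 1# (γ l ⊛ BPs y) B.⊛ e₂))
        S.≈⟨ S.*-congˡ {two₂} (S.+-cong (γᶜ-⊛ l (BPs x) e₁) (S.-‿cong (γᶜ-⊛-neg l (BPs y) e₂))) ⟩
      two₂ B.⊛ (γᶜ l B.⊛ (b₁ B.⊛ e₁) S.- γᶜ l B.⊛ (b₂ B.⊛ e₂))
        S.≈⟨ SA.solve 4 (λ t g p q → t SA.:* (g SA.:* p SA.:- g SA.:* q) SA.:= g SA.:* (t SA.:* (p SA.:- q))) S.refl two₂ (γᶜ l) (b₁ B.⊛ e₁) (b₂ B.⊛ e₂) ⟩
      γᶜ l B.⊛ (two₂ B.⊛ (b₁ B.⊛ e₁ S.- b₂ B.⊛ e₂))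
        S.≈⟨ S.*-congˡ {γᶜ l} (S.*-congˡ {two₂} (S.+-cong
             (S.*-cong (sub-≈ (BPs x) 1-0 0-1) (sub-≈ (EPs z) -0#≈0# refl))
             (S.-‿cong (S.*-cong (sub-≈ (BPs y) (-‿cong 1-0) (trans (-‿cong 0-1) (-‿involutive 1#))) (sub-≈ (EPs z) refl -0#≈0#))))) ⟨
      γᶜ l B.⊛ (two₂ B.⊛ (sub (1# - 0#) (0# - 1#) (BPs x) B.⊛ sub (- 0#) (- 1#) (EPs z)
                           S.- sub (- (1# - 0#)) (- (0# - 1#)) (BPs y) B.⊛ sub (- 1#) (- 0#) (EPs z)))
        S.≈⟨ S.*-congˡ {γᶜ l} (sub-bernoulli-euler x+y+z≈1 1# 0# 0# 1# regular) ⟩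
      γᶜ l B.⊛ (S.- (linear (1# - 0#) (0# - 1#) B.⊛ ee))
        S.≈⟨ S.*-congˡ {γᶜ l} (S.-‿cong (S.*-congʳ {ee} (sub-≈ (γ 1) 1-0 0-1))) ⟩
      γᶜ l B.⊛ (S.- (linear 1# -1# B.⊛ ee))
        S.≈⟨ SA.solve 3 (λ g c e → g SA.:* (SA.:- (c SA.:* e)) SA.:= SA.:- ((c SA.:* g) SA.:* e)) S.refl (γᶜ l) (linear 1# -1#) ee ⟩
      S.- ((linear 1# -1# B.⊛ γᶜ l) B.⊛ ee)
        S.≈⟨ S.-‿cong (S.trans (S.*-congʳ {ee} (linear-⊛-γᶜ l)) (S.*-assoc (K (nat (suc l))) (γᶜ (suc l)) ee)) ⟩
      S.- (K (nat (suc l)) B.⊛ (γᶜ (suc l) B.⊛ ee)) S.∎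
      where
      b₁ b₂ e₁ e₂ ee : B.Series
      b₁ = sub 1# -1# (BPs x)
      b₂ = sub -1# 1# (BPs y)
      e₁ = sub 0# -1# (EPs z)
      e₂ = sub -1# 0# (EPs z)
      ee = sub 1# 0# (EPs x) B.⊛ sub 0# 1# (EPs y)
      regular : SA.Regular (linear (1# - 0#) (0# - 1#))
      regular = SA.regular-cong (S.sym (sub-≈ (γ 1) 1-0 0-1)) (regular-linear-1# -1#)

    -- After the substitution it is the Euler series that carry c: E_z(c) on the left and E_x(-c) on
    -- the right. The first product has no factor in c, and the linear form in front of the
    -- right-hand side is b.
    identity₂ : ∀ l →
      two₂ B.⊛ (γᶜ l B.⊛ (sub 1# 0# (EPs z) B.⊛ sub 0# 1# (BPs x))
                S.- sub 1# -1# (γ l ⊛ EPs z) B.⊛ sub 0# -1# (BPs y))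
      S.≈ S.- (linear 0# 1# B.⊛ (K (pow -1# l) B.⊛ (sub -1# 1# (γ l ⊛ EPs x) B.⊛ sub -1# 0# (EPs y))))
    identity₂ l = S.begin
      two₂ B.⊛ (γᶜ l B.⊛ (e₁ B.⊛ b₁) S.- sub 1# -1# (γ l ⊛ EPs z) B.⊛ b₂)
        S.≈⟨ S.*-congˡ {two₂} (S.+-congˡ {γᶜ l B.⊛ (e₁ B.⊛ b₁)} (S.-‿cong (γᶜ-⊛ l (EPs z) b₂))) ⟩
      two₂ B.⊛ (γᶜ l B.⊛ (e₁ B.⊛ b₁) S.- γᶜ l B.⊛ (e₂ B.⊛ b₂))
        S.≈⟨ SA.solve 6 (λ t g b₁ e₁ b₂ e₂ → t SA.:* (g SA.:* (e₁ SA.:* b₁) SA.:- g SA.:* (e₂ SA.:* b₂))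
               SA.:= g SA.:* (t SA.:* (b₁ SA.:* e₁ SA.:- b₂ SA.:* e₂))) S.refl two₂ (γᶜ l) b₁ e₁ b₂ e₂ ⟩
      γᶜ l B.⊛ (two₂ B.⊛ (b₁ B.⊛ e₁ S.- b₂ B.⊛ e₂))
        S.≈⟨ S.*-congˡ {γᶜ l} (S.*-congˡ {two₂} (S.+-cong
             (S.*-cong (sub-≈ (BPs x) σ 1-0) (sub-≈ (EPs z) (-‿involutive 1#) -0#≈0#))
             (S.-‿cong (S.*-cong (sub-≈ (BPs y) (trans (-‿cong σ) -0#≈0#) (-‿cong 1-0)) (sub-≈ (EPs z) (-‿involutive 1#) refl))))) ⟨
      γᶜ l B.⊛ (two₂ B.⊛ (sub (-1# - -1#) (1# - 0#) (BPs x) B.⊛ sub (- -1#) (- 0#) (EPs z)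
                           S.- sub (- (-1# - -1#)) (- (1# - 0#)) (BPs y) B.⊛ sub (- -1#) (- 1#) (EPs z)))
        S.≈⟨ S.*-congˡ {γᶜ l} (sub-bernoulli-euler x+y+z≈1 -1# 1# -1# 0# regular) ⟩
      γᶜ l B.⊛ (S.- (linear (-1# - -1#) (1# - 0#) B.⊛ (sub -1# 1# (EPs x) B.⊛ e₃)))
        S.≈⟨ S.*-congˡ {γᶜ l} (S.-‿cong (S.*-congʳ {sub -1# 1# (EPs x) B.⊛ e₃} (sub-≈ (γ 1) σ 1-0))) ⟩
      γᶜ l B.⊛ (S.- (linear 0# 1# B.⊛ (sub -1# 1# (EPs x) B.⊛ e₃)))
        S.≈⟨ SA.solve 3 (λ g b e → g SA.:* (SA.:- (b SA.:* e)) SA.:= SA.:- (b SA.:* (g SA.:* e))) S.refl (γᶜ l) (linear 0# 1#) (sub -1# 1# (EPs x) B.⊛ e₃) ⟩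
      S.- (linear 0# 1# B.⊛ (γᶜ l B.⊛ (sub -1# 1# (EPs x) B.⊛ e₃)))
        S.≈⟨ S.-‿cong (S.*-congˡ {linear 0# 1#} (γᶜ-⊛-neg l (EPs x) e₃)) ⟨
      S.- (linear 0# 1# B.⊛ (K (pow -1# l) B.⊛ (sub -1# 1# (γ l ⊛ EPs x) B.⊛ e₃))) S.∎
      where
      b₁ b₂ e₁ e₂ e₃ : B.Series
      b₁ = sub 0# 1# (BPs x)
      b₂ = sub 0# -1# (BPs y)
      e₁ = sub 1# 0# (EPs z)
      e₂ = sub 1# -1# (EPs z)
      e₃ = sub -1# 0# (EPs y)
      σ : -1# - -1# ≈ 0#
      σ = -‿inverseʳ -1#
      regular : SA.Regular (linear (-1# - -1#) (1# - 0#))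
      regular = SA.regular-cong (S.sym (sub-≈ (γ 1) σ 1-0)) regular-linear-0#-1#

    identity₃ : ∀ l →
      linear 1# 0# B.⊛ (sub 1# -1# (γ l ⊛ BPs x) B.⊛ sub 0# -1# (BPs z))
        S.- linear 0# 1# B.⊛ (K (pow -1# l) B.⊛ (sub -1# 1# (γ l ⊛ BPs y) B.⊛ sub -1# 0# (BPs z)))
      S.≈ K (nat (suc l)) B.⊛ (γᶜ (suc l) B.⊛ (sub 1# 0# (BPs x) B.⊛ sub 0# 1# (BPs y)))
    identity₃ l = S.begin
      linear 1# 0# B.⊛ (sub 1# -1# (γ l ⊛ BPs x) B.⊛ d₁) S.- linear 0# 1# B.⊛ (K (pow -1# l) B.⊛ (sub -1# 1# (γ l ⊛ BPs y) B.⊛ d₂))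
        S.≈⟨ S.+-cong (S.*-congˡ {linear 1# 0#} (γᶜ-⊛ l (BPs x) d₁)) (S.-‿cong (S.*-congˡ {linear 0# 1#} (γᶜ-⊛-neg l (BPs y) d₂))) ⟩
      linear 1# 0# B.⊛ (γᶜ l B.⊛ (b₁ B.⊛ d₁)) S.- linear 0# 1# B.⊛ (γᶜ l B.⊛ (b₂ B.⊛ d₂))
        S.≈⟨ SA.solve 5 (λ a b g p q → a SA.:* (g SA.:* p) SA.:- b SA.:* (g SA.:* q) SA.:= g SA.:* (a SA.:* p SA.:- b SA.:* q))
               S.refl (linear 1# 0#) (linear 0# 1#) (γᶜ l) (b₁ B.⊛ d₁) (b₂ B.⊛ d₂) ⟩
      γᶜ l B.⊛ (linear 1# 0# B.⊛ (b₁ B.⊛ d₁) S.- linear 0# 1# B.⊛ (b₂ B.⊛ d₂))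
        S.≈⟨ S.*-congˡ {γᶜ l} (S.+-cong
             (S.*-congˡ {linear 1# 0#} (S.*-cong (sub-≈ (BPs x) 1-0 0-1) (sub-≈ (BPs z) -0#≈0# refl)))
             (S.-‿cong (S.*-congˡ {linear 0# 1#} (S.*-cong (sub-≈ (BPs y) (-‿cong 1-0) (trans (-‿cong 0-1) (-‿involutive 1#))) (sub-≈ (BPs z) refl -0#≈0#))))) ⟨
      γᶜ l B.⊛ (linear 1# 0# B.⊛ (sub (1# - 0#) (0# - 1#) (BPs x) B.⊛ sub (- 0#) (- 1#) (BPs z))
                 S.- linear 0# 1# B.⊛ (sub (- (1# - 0#)) (- (0# - 1#)) (BPs y) B.⊛ sub (- 1#) (- 0#) (BPs z)))
        S.≈⟨ S.*-congˡ {γᶜ l} (sub-bernoulli-bernoulli x+y+z≈1 1# 0# 0# 1# regular (regular-linear-1# 0#) regular-linear-0#-1#) ⟩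
      γᶜ l B.⊛ (linear (1# - 0#) (0# - 1#) B.⊛ bb)
        S.≈⟨ S.*-congˡ {γᶜ l} (S.*-congʳ {bb} (sub-≈ (γ 1) 1-0 0-1)) ⟩
      γᶜ l B.⊛ (linear 1# -1# B.⊛ bb)
        S.≈⟨ SA.solve 3 (λ g c e → g SA.:* (c SA.:* e) SA.:= (c SA.:* g) SA.:* e) S.refl (γᶜ l) (linear 1# -1#) bb ⟩
      (linear 1# -1# B.⊛ γᶜ l) B.⊛ bb
        S.≈⟨ S.trans (S.*-congʳ {bb} (linear-⊛-γᶜ l)) (S.*-assoc (K (nat (suc l))) (γᶜ (suc l)) bb) ⟩
      K (nat (suc l)) B.⊛ (γᶜ (suc l) B.⊛ bb) S.∎
      where
      b₁ b₂ d₁ d₂ bb : B.Series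
      b₁ = sub 1# -1# (BPs x)
      b₂ = sub -1# 1# (BPs y)
      d₁ = sub 0# -1# (BPs z)
      d₂ = sub -1# 0# (BPs z)
      bb = sub 1# 0# (BPs x) B.⊛ sub 0# 1# (BPs y)
      regular : SA.Regular (linear (1# - 0#) (0# - 1#))
      regular = SA.regular-cong (S.sym (sub-≈ (γ 1) 1-0 0-1)) (regular-linear-1# -1#)

suc[n∸m]≡n∸m : ∀ {m n} → suc m ≤ n → suc (n ∸ suc m) ≡ n ∸ m
suc[n∸m]≡n∸m p = ≡.sym (ℕₚ.+-∸-assoc 1 p)

-- The three identities.

module Identities {c ℓ : Level} (R : CommutativeRing c ℓ) (ι : ℚ → CommutativeRing.Carrier R)
  (ι-hom : RationalHomomorphism R ι) where
  open CommutativeRing R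
  open SetoidReasoning setoid
  open Coefficients R ι ι-hom
  open RingProperties ring using (-1*x≈-x; -‿involutive)

  ι-sgn : ∀ n → ι (sgn n) ≈ pow -1# n
  ι-sgn zero    = ι-1
  ι-sgn (suc n) = trans (ι-neg (sgn n)) (trans (-‿cong (ι-sgn n)) (sym (-1*x≈-x _)))

  sign-square : ∀ l → pow -1# l * pow -1# l ≈ 1#
  sign-square l = trans (sym (pow-* -1# -1# l))
    (trans (pow-cong (trans (-1*x≈-x -1#) (-‿involutive 1#)) l) (pow-1# l))

  sign-∸ : ∀ {l n} → l ≤ n → pow -1# (n ∸ l) ≈ pow -1# l * pow -1# n
  sign-∸ {l} {n} l≤n = begin
    pow -1# (n ∸ l)                             ≈⟨ *-identityˡ _ ⟨
    1# * pow -1# (n ∸ l)                        ≈⟨ *-congʳ (sign-square l) ⟨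
    pow -1# l * pow -1# l * pow -1# (n ∸ l)     ≈⟨ *-assoc _ _ _ ⟩
    pow -1# l * (pow -1# l * pow -1# (n ∸ l))   ≈⟨ *-congˡ (pow-+ -1# l (n ∸ l)) ⟨
    pow -1# l * pow -1# (l ℕ.+ (n ∸ l))         ≡⟨ ≡.cong (λ i → pow -1# l * pow -1# i) (ℕₚ.m+[n∸m]≡n l≤n) ⟩
    pow -1# l * pow -1# n                       ∎

  -- The function `idx` is the form in which the theorem writes the truncated index `N + k ∸ p`.
  convolution : ∀ N p M (f g : Series) (idx : ℕ → ℕ) → (∀ k → N ℕ.+ k ∸ p ≡ idx k) →
    sum (suc M) (λ k → bin M k * ((γ p ⊛ f) (N ℕ.+ k) * g (M ∸ k)))
    ≈ sum (suc M) (λ k → bin M k * bin (N ℕ.+ k) p * f (idx k) * g (M ∸ k))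
  convolution N p M f g idx e = sum-cong (suc M) (λ k → begin
    bin M k * ((γ p ⊛ f) (N ℕ.+ k) * g (M ∸ k))
      ≈⟨ *-congˡ (*-congʳ (trans (γ-⊛ p f (N ℕ.+ k)) (*-congˡ (reflexive (≡.cong f (e k)))))) ⟩
    bin M k * ((bin (N ℕ.+ k) p * f (idx k)) * g (M ∸ k))
      ≈⟨ solve 4 (λ a b c d → a :* ((b :* c) :* d) := a :* b :* c :* d) refl (bin M k) (bin (N ℕ.+ k) p) (f (idx k)) (g (M ∸ k)) ⟩
    bin M k * bin (N ℕ.+ k) p * f (idx k) * g (M ∸ k) ∎)

  halve : ∀ {X Y} → X + X ≈ Y → X ≈ ½ * Y
  halve {X} {Y} e = begin
    X              ≈⟨ *-identityˡ X ⟨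
    1# * X         ≈⟨ *-congʳ ½+½ ⟨
    (½ + ½) * X    ≈⟨ solve 2 (λ h X → (h :+ h) :* X := h :* (X :+ X)) refl ½ X ⟩
    ½ * (X + X)    ≈⟨ *-congˡ e ⟩
    ½ * Y          ∎

  sum-from-δ : ∀ l m n f → (l ≡ m → f 0 ≈ 0#) → Σ[ δ l m ≤k≤ n ] f ≈ sum (suc n) f
  sum-from-δ l m n f f0≈0 with l ℕₚ.≟ m
  ... | no _    = refl
  ... | yes l≡m = sym (trans (+-congʳ (f0≈0 l≡m)) (+-identityˡ _))

  ι-half : ∀ n → ι (ℕ→ℚ n ℚ.* inv 2) ≈ nat n * ½
  ι-half n = ι-* (ℕ→ℚ n) (inv 2)

  module _ {x y z : Carrier} (x+y+z≈1 : x + y + z ≈ 1#) where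

    part₁ : ∀ l m n → suc l ≤ m → suc l ≤ n →
      ι (sgn m) * sum (suc m) (λ k → bin m k * bin (n ℕ.+ k) l * BP (n ∸ suc l ℕ.+ k ℕ.+ 1) x * EP (m ∸ k) z)
        + ι (sgn (n ∸ suc l)) * sum (suc n) (λ k → bin n k * bin (m ℕ.+ k) l * BP (m ∸ suc l ℕ.+ k ℕ.+ 1) y * EP (n ∸ k) z)
      ≈ - (ι (ℕ→ℚ (suc l) ℚ.* inv 2)
            * sum (suc (suc l)) (λ k → ι (sgn k) * bin m k * bin n (suc l ∸ k) * EP (n ∸ suc l ℕ.+ k) x * EP (m ∸ k) y))
    part₁ l m n l<m l<n = begin
      ι (sgn m) * P + ι (sgn (n ∸ suc l)) * Q
        -- The sign with exponent `n ∸ suc l` is minus the product of those with exponents l and n,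
        -- which turns the sum of the statement into the difference of `identity₁`.
        ≈⟨ +-cong (*-congʳ (ι-sgn m)) (*-congʳ (trans (ι-sgn (n ∸ suc l)) (trans (sign-∸ l<n) (*-congʳ (-1*x≈-x _))))) ⟩
      pow -1# m * P + - pow -1# l * pow -1# n * Q
        ≈⟨ solve 5 (λ a b c P Q → a :* P :+ :- b :* c :* Q := a :* P :- b :* (c :* Q)) refl (pow -1# m) (pow -1# l) (pow -1# n) P Q ⟩
      pow -1# m * P - pow -1# l * (pow -1# n * Q)
        ≈⟨ halve (trans (+-cong extract extract) (trans (sym (two₂-⊛ _ n m)) (trans (identity₁ x+y+z≈1 l n m)
             (-‿cong (trans (K-⊛ (nat (suc l)) _ n m) (*-congˡ (trans (coefficientᶜ (EPs x) (EPs y) l<n l<m)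
               (sum-cong (suc (suc l)) (λ k → *-congʳ (*-congʳ (*-congʳ (*-congʳ (sym (ι-sgn k))))))))))))) ) ⟩
      ½ * - (nat (suc l) * T)
        ≈⟨ solve 3 (λ h a T → h :* (:- (a :* T)) := :- (a :* h :* T)) refl ½ (nat (suc l)) T ⟩
      - (nat (suc l) * ½ * T)
        ≈⟨ -‿cong (*-congʳ (ι-half (suc l))) ⟨
      - (ι (ℕ→ℚ (suc l) ℚ.* inv 2) * T) ∎
      where
      P Q T : Carrier
      P = sum (suc m) (λ k → bin m k * bin (n ℕ.+ k) l * BP (n ∸ suc l ℕ.+ k ℕ.+ 1) x * EP (m ∸ k) z)
      Q = sum (suc n) (λ k → bin n k * bin (m ℕ.+ k) l * BP (m ∸ suc l ℕ.+ k ℕ.+ 1) y * EP (n ∸ k) z)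
      T = sum (suc (suc l)) (λ k → ι (sgn k) * bin m k * bin n (suc l ∸ k) * EP (n ∸ suc l ℕ.+ k) x * EP (m ∸ k) y)
      index : ∀ {N} → suc l ≤ N → ∀ k → N ℕ.+ k ∸ l ≡ N ∸ suc l ℕ.+ k ℕ.+ 1
      index {N} l<N k = ≡.trans (ℕₚ.+-∸-comm k (ℕₚ.<⇒≤ l<N))
        (≡.trans (≡.cong (ℕ._+ k) (≡.sym (suc[n∸m]≡n∸m l<N))) (ℕₚ.+-comm 1 (N ∸ suc l ℕ.+ k)))
      extract : pow -1# m * P - pow -1# l * (pow -1# n * Q)
        ≈ (sub 1# -1# (γ l ⊛ BPs x) B.⊛ sub 0# -1# (EPs z)
            S.- K (pow -1# l) B.⊛ (sub -1# 1# (γ l ⊛ BPs y) B.⊛ sub -1# 0# (EPs z))) n m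
      extract = +-cong
        (sym (trans (coefficientᵇ (γ l ⊛ BPs x) (EPs z) n m) (*-congˡ (convolution n l m (BPs x) (EPs z) (λ k → n ∸ suc l ℕ.+ k ℕ.+ 1) (index l<n)))))
        (-‿cong (sym (trans (K-⊛ (pow -1# l) _ n m) (*-congˡ
          (trans (coefficientᵃ (γ l ⊛ BPs y) (EPs z) n m) (*-congˡ (convolution m l n (BPs y) (EPs z) (λ k → m ∸ suc l ℕ.+ k ℕ.+ 1) (index l<m))))))))

    part₂ : ∀ l m n → l ≤ suc m → l ≤ n →
      sum (suc l) (λ k → ι (sgn k) * bin (suc m) k * bin n (l ∸ k) * BP (suc m ∸ k) x * EP (n ∸ l ℕ.+ k) z)
        - ι (sgn (suc m)) * sum (suc (suc m)) (λ k → bin (suc m) k * bin (n ℕ.+ k) l * BP (suc m ∸ k) y * EP (n ∸ l ℕ.+ k) z)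
      ≈ ι (sgn (n ∸ l ℕ.+ 1)) * ι (ℕ→ℚ (suc m) ℚ.* inv 2)
          * Σ[ δ l (suc m) ≤k≤ n ] (λ k → bin n k * bin (m ℕ.+ k) l * EP (n ∸ k) y * EP (suc m ℕ.+ k ∸ (l ℕ.+ 1)) x)
    part₂ l m n l≤m l≤n = begin
      P - ι (sgn (suc m)) * Q
        ≈⟨ halve (trans (+-cong extract extract) (trans (sym (two₂-⊛ _ n (suc m))) (trans (identity₂ x+y+z≈1 l n (suc m)) (-‿cong derivative)))) ⟩
      ½ * - (nat (suc m) * (pow -1# l * (pow -1# n * T)))
        ≈⟨ solve 5 (λ h a b c T → h :* (:- (a :* (b :* (c :* T)))) := :- (b :* c) :* (a :* h) :* T) refl ½ (nat (suc m)) (pow -1# l) (pow -1# n) T ⟩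
      - (pow -1# l * pow -1# n) * (nat (suc m) * ½) * T
        ≈⟨ *-cong (*-cong sign (ι-half (suc m))) (sum-from-δ l (suc m) n t t-vanishes) ⟨
      ι (sgn (n ∸ l ℕ.+ 1)) * ι (ℕ→ℚ (suc m) ℚ.* inv 2) * Σ[ δ l (suc m) ≤k≤ n ] t ∎
      where
      t : ℕ → Carrier
      t k = bin n k * bin (m ℕ.+ k) l * EP (n ∸ k) y * EP (suc m ℕ.+ k ∸ (l ℕ.+ 1)) x
      P Q T : Carrier
      P = sum (suc l) (λ k → ι (sgn k) * bin (suc m) k * bin n (l ∸ k) * BP (suc m ∸ k) x * EP (n ∸ l ℕ.+ k) z)
      Q = sum (suc (suc m)) (λ k → bin (suc m) k * bin (n ℕ.+ k) l * BP (suc m ∸ k) y * EP (n ∸ l ℕ.+ k) z)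
      T = sum (suc n) t
      swap : ∀ a b c d → a * b * c * d ≈ a * b * d * c
      swap = solve 4 (λ a b c d → a :* b :* c :* d := a :* b :* d :* c) refl
      extract : P - ι (sgn (suc m)) * Q
        ≈ (γᶜ l B.⊛ (sub 1# 0# (EPs z) B.⊛ sub 0# 1# (BPs x))
            S.- sub 1# -1# (γ l ⊛ EPs z) B.⊛ sub 0# -1# (BPs y)) n (suc m)
      extract = +-cong
        (sym (trans (coefficientᶜ (EPs z) (BPs x) l≤n l≤m) (sum-cong (suc l) (λ k →
          trans (swap _ _ _ _) (*-congʳ (*-congʳ (*-congʳ (*-congʳ (sym (ι-sgn k))))))))))
        (-‿cong (sym (trans (coefficientᵇ (γ l ⊛ EPs z) (BPs y) n (suc m)) (*-cong (sym (ι-sgn (suc m)))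
          (trans (convolution n l (suc m) (EPs z) (BPs y) (λ k → n ∸ l ℕ.+ k) (λ k → ℕₚ.+-∸-comm k l≤n)) (sum-cong (suc (suc m)) (λ k → swap _ _ _ _)))))))
      -- The factor b lowers the degree `suc m` to m and contributes `suc m`; with m now the
      -- theorem's m - 1, this accounts for the factor m/2 and the upper index m + k - 1.
      derivative : (linear 0# 1# B.⊛ (K (pow -1# l) B.⊛ (sub -1# 1# (γ l ⊛ EPs x) B.⊛ sub -1# 0# (EPs y)))) n (suc m)
        ≈ nat (suc m) * (pow -1# l * (pow -1# n * T))
      derivative = trans (linear-⊛ 0# 1# F n (suc m)) (trans (+-cong (zeroˡ _) (*-identityˡ _))
        (trans (+-identityˡ _) (*-congˡ (trans (K-⊛ (pow -1# l) _ n m) (*-congˡ (trans (coefficientᵃ (γ l ⊛ EPs x) (EPs y) n m)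
          (*-congˡ (trans (convolution m l n (EPs x) (EPs y) (λ k → suc m ℕ.+ k ∸ (l ℕ.+ 1)) (λ k → ≡.cong (suc m ℕ.+ k ∸_) (ℕₚ.+-comm 1 l)))
            (sum-cong (suc n) (λ k → swap _ _ _ _))))))))))
        where
        F : B.Series
        F = K (pow -1# l) B.⊛ (sub -1# 1# (γ l ⊛ EPs x) B.⊛ sub -1# 0# (EPs y))
      -- The exponent n - l + 1 has the parity of n - l - 1 and stays a natural number when l = n.
      sign : ι (sgn (n ∸ l ℕ.+ 1)) ≈ - (pow -1# l * pow -1# n)
      sign = trans (reflexive (≡.cong (λ i → ι (sgn i)) (ℕₚ.+-comm (n ∸ l) 1)))
        (trans (ι-sgn (suc (n ∸ l))) (trans (-1*x≈-x _) (-‿cong (sign-∸ l≤n))))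
      -- For l equal to the theorem's m the Euler polynomial at k = 0 would have index -1.
      -- Truncation replaces it by index 0, but the coefficient C(m - 1, m) of this term vanishes,
      -- so the full sum and the sum from k = 1 agree.
      t-vanishes : l ≡ suc m → t 0 ≈ 0#
      t-vanishes l≡1+m = trans (*-congʳ (trans (*-congʳ (trans (*-congˡ (bin-> {m ℕ.+ 0} {l}
        (ℕₚ.≤-trans (s≤s (ℕₚ.≤-reflexive (ℕₚ.+-identityʳ m))) (ℕₚ.≤-reflexive (≡.sym l≡1+m))))) (zeroʳ _))) (zeroˡ _))) (zeroˡ _)

    -- The variables a and b in front of the two products contribute the weights `suc n` and
    -- `suc m`. Multiplying the statement by both weights makes each inverse cancel one of them and
    -- leaves the other, as `identity₃` requires.
    part₃ : ∀ l m n → l ≤ m → l ≤ n →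
      ι (sgn (suc m) ℚ.* inv (suc m)) * sum (suc (suc m)) (λ k → bin (suc m) k * bin (n ℕ.+ k) l * BP (n ∸ l ℕ.+ k) x * BP (suc m ∸ k) z)
        + ι (sgn (suc l)) * ι (sgn (suc n) ℚ.* inv (suc n))
            * sum (suc (suc n)) (λ k → bin (suc n) k * bin (m ℕ.+ k) l * BP (m ∸ l ℕ.+ k) y * BP (suc n ∸ k) z)
      ≈ ι (ℕ→ℚ (suc l) ℚ.* inv (suc m ℕ.* suc n))
          * sum (suc (suc l)) (λ k → ι (sgn k) * bin (suc m) k * bin (suc n) (suc l ∸ k) * BP (n ∸ l ℕ.+ k) x * BP (suc m ∸ k) y)
    part₃ l m n l≤m l≤n = cancel (regular-* (regular-nat-suc m) (regular-nat-suc n)) _ _ (begin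
      μ * ν * (ι (sgn (suc m) ℚ.* inv (suc m)) * P + ι (sgn (suc l)) * ι (sgn (suc n) ℚ.* inv (suc n)) * Q)
        ≈⟨ *-congˡ (+-cong (*-congʳ (trans (ι-* (sgn (suc m)) (inv (suc m))) (*-congʳ (ι-sgn (suc m)))))
             (*-congʳ (*-cong (trans (ι-sgn (suc l)) (-1*x≈-x _)) (trans (ι-* (sgn (suc n)) (inv (suc n))) (*-congʳ (ι-sgn (suc n))))))) ⟩
      μ * ν * (pow -1# (suc m) * ι (inv (suc m)) * P + - pow -1# l * (pow -1# (suc n) * ι (inv (suc n))) * Q)
        ≈⟨ solve 9 (λ μ ν a i P b c j Q → μ :* ν :* (a :* i :* P :+ :- b :* (c :* j) :* Q)
             := (i :* μ) :* (ν :* (a :* P)) :- (j :* ν) :* (μ :* (b :* (c :* Q)))) refl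
             μ ν (pow -1# (suc m)) (ι (inv (suc m))) P (pow -1# l) (pow -1# (suc n)) (ι (inv (suc n))) Q ⟩
      ι (inv (suc m)) * μ * (ν * (pow -1# (suc m) * P)) - ι (inv (suc n)) * ν * (μ * (pow -1# l * (pow -1# (suc n) * Q)))
        ≈⟨ +-cong (trans (*-congʳ (ι-inv-nat m)) (*-identityˡ _)) (-‿cong (trans (*-congʳ (ι-inv-nat n)) (*-identityˡ _))) ⟩
      ν * (pow -1# (suc m) * P) - μ * (pow -1# l * (pow -1# (suc n) * Q))
        ≈⟨ +-cong (sym derivativeᵃ) (-‿cong (sym derivativeᵇ)) ⟩
      (linear 1# 0# B.⊛ F S.- linear 0# 1# B.⊛ G) (suc n) (suc m)
        ≈⟨ identity₃ x+y+z≈1 l (suc n) (suc m) ⟩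
      (K (nat (suc l)) B.⊛ (γᶜ (suc l) B.⊛ (sub 1# 0# (BPs x) B.⊛ sub 0# 1# (BPs y)))) (suc n) (suc m)
        ≈⟨ trans (K-⊛ (nat (suc l)) _ (suc n) (suc m)) (*-congˡ (trans (coefficientᶜ (BPs x) (BPs y) (s≤s l≤n) (s≤s l≤m))
             (sum-cong (suc (suc l)) (λ k → *-congʳ (*-congʳ (*-congʳ (*-congʳ (sym (ι-sgn k))))))))) ⟩
      nat (suc l) * T
        -- `n + m * suc n` is the predecessor of `suc m * suc n`, the form in which `ι-inv-nat`
        -- takes its argument.
        ≈⟨ trans (*-congʳ (trans (*-congˡ (ι-inv-nat (n ℕ.+ m ℕ.* suc n))) (*-identityʳ _))) refl ⟨
      nat (suc l) * (ι (inv (suc m ℕ.* suc n)) * nat (suc m ℕ.* suc n)) * T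
        ≈⟨ *-congʳ (*-congˡ (*-congˡ (nat-* (suc m) (suc n)))) ⟩
      nat (suc l) * (ι (inv (suc m ℕ.* suc n)) * (μ * ν)) * T
        ≈⟨ solve 4 (λ a i μν T → a :* (i :* μν) :* T := μν :* (a :* i :* T)) refl (nat (suc l)) (ι (inv (suc m ℕ.* suc n))) (μ * ν) T ⟩
      μ * ν * (nat (suc l) * ι (inv (suc m ℕ.* suc n)) * T)
        ≈⟨ *-congˡ (*-congʳ (ι-* (ℕ→ℚ (suc l)) (inv (suc m ℕ.* suc n)))) ⟨
      μ * ν * (ι (ℕ→ℚ (suc l) ℚ.* inv (suc m ℕ.* suc n)) * T) ∎)
      where
      μ ν P Q T : Carrier
      μ = nat (suc m)
      ν = nat (suc n)
      P = sum (suc (suc m)) (λ k → bin (suc m) k * bin (n ℕ.+ k) l * BP (n ∸ l ℕ.+ k) x * BP (suc m ∸ k) z)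
      Q = sum (suc (suc n)) (λ k → bin (suc n) k * bin (m ℕ.+ k) l * BP (m ∸ l ℕ.+ k) y * BP (suc n ∸ k) z)
      T = sum (suc (suc l)) (λ k → ι (sgn k) * bin (suc m) k * bin (suc n) (suc l ∸ k) * BP (n ∸ l ℕ.+ k) x * BP (suc m ∸ k) y)
      F G : B.Series
      F = sub 1# -1# (γ l ⊛ BPs x) B.⊛ sub 0# -1# (BPs z)
      G = K (pow -1# l) B.⊛ (sub -1# 1# (γ l ⊛ BPs y) B.⊛ sub -1# 0# (BPs z))
      derivativeᵃ : (linear 1# 0# B.⊛ F) (suc n) (suc m) ≈ ν * (pow -1# (suc m) * P)
      derivativeᵃ = trans (linear-⊛ 1# 0# F (suc n) (suc m)) (trans (+-cong (*-identityˡ _) (zeroˡ _)) (trans (+-identityʳ _)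
        (*-congˡ (trans (coefficientᵇ (γ l ⊛ BPs x) (BPs z) n (suc m))
          (*-congˡ (convolution n l (suc m) (BPs x) (BPs z) (λ k → n ∸ l ℕ.+ k) (λ k → ℕₚ.+-∸-comm k l≤n)))))))
      derivativeᵇ : (linear 0# 1# B.⊛ G) (suc n) (suc m) ≈ μ * (pow -1# l * (pow -1# (suc n) * Q))
      derivativeᵇ = trans (linear-⊛ 0# 1# G (suc n) (suc m)) (trans (+-cong (zeroˡ _) (*-identityˡ _)) (trans (+-identityˡ _)
        (*-congˡ (trans (K-⊛ (pow -1# l) _ (suc n) m) (*-congˡ (trans (coefficientᵃ (γ l ⊛ BPs y) (BPs z) (suc n) m)
          (*-congˡ (convolution m l (suc n) (BPs y) (BPs z) (λ k → m ∸ l ℕ.+ k) (λ k → ℕₚ.+-∸-comm k l≤m)))))))))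

theorem1p2 : {c ℓ : Level} (R : CommutativeRing c ℓ) (ι : ℚ → CommutativeRing.Carrier R) →
  RingMorphisms.IsRingHomomorphism (CommutativeRing.rawRing +-*-commutativeRing) (CommutativeRing.rawRing R) ι →
  (l m n : ℕ) → 1 ≤ l → l ≤ m → l ≤ n →
  (x y z : CommutativeRing.Carrier R) →
  let open CommutativeRing R
      open Poly R ι
  in x + y + z ≈ 1# →
    ((q (sgn m) * Σ[ 0 ≤k≤ m ] (λ k → bin m k * bin (n ℕ.+ k) (l ∸ 1) * BP (n ∸ l ℕ.+ k ℕ.+ 1) x * EP (m ∸ k) z)
      + q (sgn (n ∸ l)) * Σ[ 0 ≤k≤ n ] (λ k → bin n k * bin (m ℕ.+ k) (l ∸ 1) * BP (m ∸ l ℕ.+ k ℕ.+ 1) y * EP (n ∸ k) z))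
     ≈ - (q (ℕ→ℚ l ℚ.* inv 2) * Σ[ 0 ≤k≤ l ] (λ k → q (sgn k) * bin m k * bin n (l ∸ k) * EP (n ∸ l ℕ.+ k) x * EP (m ∸ k) y)))
    ×
    ((Σ[ 0 ≤k≤ l ] (λ k → q (sgn k) * bin m k * bin n (l ∸ k) * BP (m ∸ k) x * EP (n ∸ l ℕ.+ k) z)
      - q (sgn m) * Σ[ 0 ≤k≤ m ] (λ k → bin m k * bin (n ℕ.+ k) l * BP (m ∸ k) y * EP (n ∸ l ℕ.+ k) z))
     ≈ q (sgn (n ∸ l ℕ.+ 1)) * q (ℕ→ℚ m ℚ.* inv 2)
         * Σ[ δ l m ≤k≤ n ] (λ k → bin n k * bin (m ℕ.+ k ∸ 1) l * EP (n ∸ k) y * EP (m ℕ.+ k ∸ (l ℕ.+ 1)) x))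
    ×
    ((q (sgn m ℚ.* inv m) * Σ[ 0 ≤k≤ m ] (λ k → bin m k * bin (n ℕ.+ k ∸ 1) (l ∸ 1) * BP (n ∸ l ℕ.+ k) x * BP (m ∸ k) z)
      + q (sgn l) * q (sgn n ℚ.* inv n) * Σ[ 0 ≤k≤ n ] (λ k → bin n k * bin (m ℕ.+ k ∸ 1) (l ∸ 1) * BP (m ∸ l ℕ.+ k) y * BP (n ∸ k) z))
     ≈ q (ℕ→ℚ l ℚ.* inv (m ℕ.* n)) * Σ[ 0 ≤k≤ l ] (λ k → q (sgn k) * bin m k * bin n (l ∸ k) * BP (n ∸ l ℕ.+ k) x * BP (m ∸ k) y))
theorem1p2 R ι ι-hom (suc l) (suc m) (suc n) _ (s≤s l≤m) (s≤s l≤n) x y z x+y+z≈1 =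
  -- Each part takes predecessors where the statement subtracts 1: of l in the first, of m in the
  -- second, of all three in the third. The truncated subtractions of 1 then compute away.
  part₁ x+y+z≈1 l (suc m) (suc n) (s≤s l≤m) (s≤s l≤n) ,
  part₂ x+y+z≈1 (suc l) m (suc n) (s≤s l≤m) (s≤s l≤n) ,
  part₃ x+y+z≈1 l m n l≤m l≤n
  where open Identities R ι ι-hom
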